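{- Let $\mathbf H$ be a finite connected ordered hypergraph and let $S,T$ be two constructions of $\mathbf H$. Then: (1) If $S\lessdot_{\mathrm{flip}}T$, then $S\lessdot^+T$. (2) If $\mathbf H$ is hereditarily ordered and $S\lessdot^+T$, then $S\lessdot_{\mathrm{flip}}^+T$. Here $^+$ denotes transitive closure (of $\lessdot$ on the set of all constructs of $\mathbf H$, and of $\lessdot_{\mathrm{flip}}$ on the set of all constructions of $\mathbf H$, respectively).
   Context: A (finite) hypergraph $\mathbf H$ with finite vertex set $H$ is a set of non-empty subsets of $H$ (hyperedges) with $\bigcup\mathbf H=H$ and $\{x\}\in\mathbf H$ for all $x\in H$. For $X\subseteq H$, $\mathbf H_X:=\{Z\in\mathbf H: Z\subseteq X\}$ and $\mathbf H\setminus X:=\mathbf H_{H\setminus X}$. $\mathbf H$ is connected if there is no partition $H=X_1\cup X_2$ into two non-empty parts with $\mathbf H=\mathbf H_{X_1}\cup\mathbf H_{X_2}$. Every hypergraph is uniquely the union of its connected components; $\mathbf H,X\leadsto H_1,\dots,H_n$ means that $\mathbf H_{H_1},\dots,\mathbf H_{H_n}$ are the connected components of $\mathbf H\setminus X$. Constructs of a connected hypergraph $\mathbf H$ are non-planar rooted trees with nodes labelled by non-empty subsets of $H$, defined recursively: the one-node tree labelled $H$ is a construct of $\mathbf H$; if $\emptyset\neq Y\subsetneq H$, $\mathbf H,Y\leadsto H_1,\dots,H_n$, and $T_i$ is a construct of $\mathbf H_{H_i}$ for each $i$, then the tree $Y(T_1,\dots,T_n)$ with root $Y$ and immediate subtrees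 $T_1,\dots,T_n$ is a construct of $\mathbf H$. Nodes are identified with their labels (the labels partition $H$). A construction is a construct all of whose nodes are singletons. $\mathbf H$ is ordered if $H$ carries a total order; for non-empty $Y,Z\subseteq H$, $Y<Z$ (or $Z>Y$) means $\max Y<\min Z$. An ordered $\mathbf H$ is hereditarily ordered if for every non-empty $X\subseteq H$ the components in $\mathbf H,X\leadsto H_1,\dots,H_n$ can be indexed so that $H_1<H_2<\cdots<H_n$. If in a construct $S$ the node $X$ is the parent of the node $Y$, contracting the edge between them and labelling the merged node $X\cup Y$ yields a construct $T$; write $S\subset_{X,Y}T$. For constructs $S,S'$ of $\mathbf H$, $S\lessdot S'$ iff there exist $U,V$ with $U>V$ such that either $S\subset_{U,V}S'$ (fusion) or $S'\subset_{V,U}S$ (split). Flips: let $S$ be a construction of $\mathbf H$ with $\{x\}$ the parent of $\{y\}$ and $y<x$. Let $G$ be the union of the labels of $\{x\}$ and all its descendants in $S$, and $\mathbf G=\mathbf H_G$. The subtree of $S$ rooted at $\{x\}$ consists of $x$, its child $y$, and, for each connected component $C$ of $\mathbf G\setminus\{x,y\}$, a construction $S_C$ of $\mathbf G_C$ (attached to $x$ or to $y$). $\mathsf{Flip}_S(x,y)$ is obtained from $S$ by replacing this subtree with the one having root $\{y\}$, whose children are: a node $\{x\}$, carrying as immediate subtrees those $S_C$ with $C$ contained in the connected component of $\mathbf G\setminus\{y\}$ containing $x$; and all the remaining $S_C$. For constructions $S,T$, $S\lessdot_{\mathrm{flip}}T$ iff $T=\mathsf{Flip}_S(x,y)$ for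 some such $x,y$. -}

module Defs where

open import Data.Fin.Base using (Fin)
open import Data.Fin.Subset
open import Data.Fin.Subset.Properties
  using (_⊆?_; p∩q⊆p; x∈p∩q⁺; x∈p∩q⁻; x∈⁅y⁆⇒x≡y)
open import Data.List.Base using (List; []; _∷_; _++_; filter)
open import Data.List.Membership.Propositional using () renaming (_∈_ to _∈ˡ_)
open import Data.List.Relation.Binary.Permutation.Homogeneous using (Permutation)
open import Data.List.Relation.Binary.Pointwise.Base using (Pointwise)
open import Data.List.Relation.Unary.All using (All)
open import Data.List.Relation.Unary.AllPairs using (AllPairs)
open import Data.List.Relation.Unary.Any using (Any)
open import Data.List.Relation.Unary.Linked using (Linked)
open import Data.Nat.Base using (ℕ)
open import Data.Product.Base using (∃; ∃₂; _×_; _,_; proj₁; proj₂)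
open import Data.Sum.Base using (_⊎_)
open import Level using (0ℓ)
open import Relation.Binary.Core using (Rel)
open import Relation.Binary.Structures using (IsTotalOrder)
open import Relation.Binary.PropositionalEquality using (_≡_; _≢_; sym; subst)
open import Relation.Nullary using (¬_)
open import Relation.Nullary.Decidable using (_×-dec_; ¬?)
open import Relation.Unary using (Pred; Decidable; _≐_) renaming (_∪_ to _∪ᵖ_)

private
  variable
    n : ℕ

------------------------------------------------------------------------
-- Hypergraphs

-- The vertex set is a subset of an ambient Fin n, so that a hypergraph
-- and its restrictions live in the same type.  Of the condition that the
-- union of the hyperedges equals the vertex set, `edge⊆vertices` is one
-- inclusion; the other one follows from `singleton`.  Decidability of
-- IsEdge makes the hyperedges an honest finite set of subsets.
record Hypergraph (n : ℕ) : Set₁ where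
  field
    vertices      : Subset n
    IsEdge        : Pred (Subset n) 0ℓ
    isEdge?       : Decidable IsEdge
    edge-nonempty : ∀ {Z} → IsEdge Z → Nonempty Z
    edge⊆vertices : ∀ {Z} → IsEdge Z → Z ⊆ vertices
    singleton     : ∀ {x} → x ∈ vertices → IsEdge ⁅ x ⁆

open Hypergraph

infixl 8 _↾_ _∖_

-- 𝐇_X.  The intersection makes the operation total; it is X itself when
-- X ⊆ vertices H.
_↾_ : Hypergraph n → Subset n → Hypergraph n
H ↾ X = record
  { vertices      = vertices H ∩ X
  ; IsEdge        = λ Z → IsEdge H Z × Z ⊆ X
  ; isEdge?       = λ Z → isEdge? H Z ×-dec (Z ⊆? X)
  ; edge-nonempty = λ (e , _) → edge-nonempty H e
  ; edge⊆vertices = λ (e , Z⊆X) z∈Z → x∈p∩q⁺ (edge⊆vertices H e z∈Z , Z⊆X z∈Z)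
  ; singleton     = λ {x} x∈ → singleton H (p∩q⊆p (vertices H) X x∈)
                  , λ y∈ → subst (_∈ X) (sym (x∈⁅y⁆⇒x≡y x y∈))
                                 (proj₂ (x∈p∩q⁻ (vertices H) X x∈))
  }

_∖_ : Hypergraph n → Subset n → Hypergraph n
H ∖ X = H ↾ (vertices H ─ X)

Disjoint : Rel (Subset n) 0ℓ
Disjoint X Y = Empty (X ∩ Y)

Connected : Hypergraph n → Set
Connected H = ∀ X₁ X₂ →
  Nonempty X₁ → Nonempty X₂ → Disjoint X₁ X₂ → X₁ ∪ X₂ ≡ vertices H →
  ¬ (IsEdge H ≐ (IsEdge (H ↾ X₁) ∪ᵖ IsEdge (H ↾ X₂)))

-- Cs lists, without repetition and in some order, the vertex sets of the
-- connected components of H.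
record Components (H : Hypergraph n) (Cs : List (Subset n)) : Set where
  field
    nonempty  : All Nonempty Cs
    disjoint  : AllPairs Disjoint Cs
    covers    : ⋃ Cs ≡ vertices H
    connected : All (λ C → Connected (H ↾ C)) Cs
    edges     : IsEdge H ≐ (λ Z → Any (λ C → IsEdge (H ↾ C) Z) Cs)

infix 4 _﹐_⤳_

_﹐_⤳_ : Hypergraph n → Subset n → List (Subset n) → Set
H ﹐ X ⤳ Cs = Components (H ∖ X) Cs

IsComponent : Hypergraph n → Subset n → Set
IsComponent H C = ∃ λ Cs → Components H Cs × C ∈ˡ Cs

------------------------------------------------------------------------
-- Constructs

data Tree (n : ℕ) : Set where
  node : Subset n → List (Tree n) → Tree n

-- Equality of non-planar trees: children are compared up to reordering,
-- at every level.
infix 4 _≈_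

data _≈_ {n} : Rel (Tree n) 0ℓ where
  node : ∀ {X ts us} → Permutation _≈_ ts us → node X ts ≈ node X us

data AllNodes (P : Pred (Subset n) 0ℓ) : Pred (Tree n) 0ℓ where
  node : ∀ {X ts} → P X → All (AllNodes P) ts → AllNodes P (node X ts)

support  : Tree n → Subset n
supports : List (Tree n) → Subset n

support (node X ts) = X ∪ supports ts

supports []       = ⊥
supports (t ∷ ts) = support t ∪ supports ts

data IsConstruct (H : Hypergraph n) : Pred (Tree n) 0ℓ where
  leaf   : Nonempty (vertices H) → IsConstruct H (node (vertices H) [])
  branch : ∀ {Y Cs ts} → Nonempty Y → Y ⊂ vertices H → H ﹐ Y ⤳ Cs →
           Pointwise (λ C t → IsConstruct (H ↾ C) t) Cs ts →
           IsConstruct H (node Y ts)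

record Construct (H : Hypergraph n) : Set where
  field
    tree        : Tree n
    isConstruct : IsConstruct H tree

IsSingleton : Pred (Subset n) 0ℓ
IsSingleton X = ∃ λ x → X ≡ ⁅ x ⁆

record Construction (H : Hypergraph n) : Set where
  field
    construct  : Construct H
    singletons : AllNodes IsSingleton (Construct.tree construct)

  open Construct construct public

open Construction using (construct) public

-- Contraction of the edge from a node X to its child Y, for a planar
-- representative in which that edge is on the leftmost branch.
data Contracts {n} (X Y : Subset n) : Rel (Tree n) 0ℓ where
  here  : ∀ {us ts} →
          Contracts X Y (node X (node Y us ∷ ts)) (node (X ∪ Y) (us ++ ts))
  there : ∀ {Z t t′ ts} → Contracts X Y t t′ →
          Contracts X Y (node Z (t ∷ ts)) (node Z (t′ ∷ ts))

-- Every non-planar tree has, for each of its edges, a representative as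
-- required by Contracts.
infix 4 _⊂[_,_]_

_⊂[_,_]_ : Tree n → Subset n → Subset n → Tree n → Set
S ⊂[ X , Y ] T = ∃₂ λ S′ T′ → S ≈ S′ × Contracts X Y S′ T′ × T′ ≈ T

-- Flip of the edge from ⁅ x ⁆ to its child ⁅ y ⁆, again on the leftmost
-- branch of a planar representative.  The list as ++ bs consists of the
-- constructions S_C, and C is recovered as the support of S_C.
data Flips {n} (H : Hypergraph n) (x y : Fin n) : Rel (Tree n) 0ℓ where
  here  : ∀ {as bs K} →
          let G = support (node ⁅ x ⁆ (node ⁅ y ⁆ as ∷ bs)) in
          IsComponent ((H ↾ G) ∖ ⁅ y ⁆) K → x ∈ K →
          Flips H x y
            (node ⁅ x ⁆ (node ⁅ y ⁆ as ∷ bs))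
            (node ⁅ y ⁆ (node ⁅ x ⁆ (filter (λ t → support t ⊆? K) (as ++ bs))
                         ∷ filter (λ t → ¬? (support t ⊆? K)) (as ++ bs)))
  there : ∀ {Z t t′ ts} → Flips H x y t t′ →
          Flips H x y (node Z (t ∷ ts)) (node Z (t′ ∷ ts))

-- T = Flip_S(x,y), as non-planar trees.
FlipsTo : Hypergraph n → Tree n → Fin n → Fin n → Tree n → Set
FlipsTo H S x y T = ∃₂ λ S′ T′ → S ≈ S′ × Flips H x y S′ T′ × T′ ≈ T

------------------------------------------------------------------------
-- Ordered hypergraphs

-- The order is given on the ambient Fin n (it need not be the usual order
-- there); every total order on the vertex set extends to such an order.
record OrderedHypergraph (n : ℕ) : Set₁ where
  infix 4 _≤_ _<_ _<ˢ_ _⋖_ _⋖flip_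

  field
    hypergraph   : Hypergraph n
    _≤_          : Rel (Fin n) 0ℓ
    isTotalOrder : IsTotalOrder _≡_ _≤_

  _<_ : Rel (Fin n) 0ℓ
  x < y = x ≤ y × x ≢ y

  IsMax IsMin : Subset n → Pred (Fin n) 0ℓ
  IsMax X m = m ∈ X × (∀ {x} → x ∈ X → x ≤ m)
  IsMin X m = m ∈ X × (∀ {x} → x ∈ X → m ≤ x)

  _<ˢ_ : Rel (Subset n) 0ℓ
  Y <ˢ Z = ∃₂ λ a b → IsMax Y a × IsMin Z b × a < b

  HereditarilyOrdered : Set
  HereditarilyOrdered = ∀ X → Nonempty X → X ⊆ vertices hypergraph →
    ∃ λ Cs → hypergraph ﹐ X ⤳ Cs × Linked _<ˢ_ Cs

  _⋖_ : Rel (Construct hypergraph) 0ℓ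
  S ⋖ S′ = ∃₂ λ U V → V <ˢ U × (tree S ⊂[ U , V ] tree S′ ⊎ tree S′ ⊂[ V , U ] tree S)
    where open Construct

  _⋖flip_ : Rel (Construction hypergraph) 0ℓ
  S ⋖flip T = ∃₂ λ x y → y < x × FlipsTo hypergraph (tree S) x y (tree T)
    where open Construction

{-# OPTIONS --safe #-}

-- A construct is determined by its tubes, the supports of its subtrees: contracting an edge removes
-- one tube, and a flip exchanges one tube for another.  A flip is therefore a contraction followed
-- by a split, which gives (1).  For (2), call P good if S ≼ M for every construction M all of whose
-- tubes include those of P, where ≼ is the reflexive transitive closure of the flip relation.
-- S is good, and goodness passes through a split because a split only adds a tube.  In a fusion of
-- U with its child V, the tube D of V is lost; but a construction M that has all the other tubes
-- can be brought, by undoing flips of some m ∈ U over some r ∈ V (so r < m), to one that has D as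
-- well, by moving U up until D is cut off.  Finally, the last step into the construction T is
-- a split, and undoing the corresponding flip makes the chain from S to T nonempty.

module Submission where

open import Defs
open import Data.Empty using (⊥-elim)
open import Data.Fin.Base using (Fin)
open import Data.Fin.Subset
open import Data.Fin.Subset.Induction using (⊂-wellFounded)
open import Data.Fin.Subset.Properties
open import Data.List.Base using (List; []; _∷_; _++_; filter; map)
open import Data.List.Membership.Propositional using (lose) renaming (_∈_ to _∈ˡ_)
open import Data.List.Properties
  using (partition-defn; filter-++; filter-all; filter-none; ++-identityʳ)
open import Data.List.Relation.Binary.Permutation.Homogeneous
  using (Permutation; refl; prep; swap; trans)
import Data.List.Relation.Binary.Permutation.Setoid as SetoidPermutation
import Data.List.Relation.Binary.Permutation.Setoid.Properties as SetoidPermutationProperties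
open import Data.List.Relation.Binary.Pointwise.Base using (Pointwise; []; _∷_)
open import Data.List.Relation.Unary.All as All using (All; []; _∷_)
import Data.List.Relation.Unary.All.Properties as All
open import Data.List.Relation.Unary.AllPairs using (AllPairs; []; _∷_)
import Data.List.Relation.Unary.AllPairs.Properties as AllPairs
open import Data.List.Relation.Unary.Any as Any using (Any; here; there)
import Data.List.Relation.Unary.Any.Properties as Any
open import Data.Nat.Base using (ℕ)
open import Data.Product.Base using (∃; ∃₂; _×_; _,_; proj₁; proj₂)
open import Data.Sum.Base using (_⊎_; inj₁; inj₂; [_,_]′)
open import Data.Vec.Base using ([]; _∷_; here; there)
open import Function.Base using (_∘_; _on_; id)
open import Induction.WellFounded using (Acc; acc)
open import Level using (0ℓ)
open import Relation.Binary.Bundles using (Setoid)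
open import Relation.Binary.Construct.Closure.Transitive as TransClosure
  using (TransClosure; [_]; _∷_)
open import Relation.Binary.Core using (Rel)
open import Relation.Binary.Definitions using (_Respects_)
open import Relation.Binary.PropositionalEquality as ≡
  using (_≡_; _≢_; refl; sym; cong; cong₂; subst)
open import Relation.Binary.Structures using (IsTotalOrder)
open import Relation.Nullary using (¬_; yes; no)
open import Relation.Nullary.Decidable using (_×-dec_; ¬?)
open import Relation.Unary using (Pred; Decidable)

open Hypergraph

private
  variable
    n : ℕ
    x : Fin n
    X Y Z : Subset n
    t u : Tree n
    ts us : List (Tree n)

-- Subsets and supports of trees

disjoint⁻ : Disjoint X Y → x ∈ X → x ∉ Y
disjoint⁻ d x∈X x∈Y = d (_ , x∈p∩q⁺ (x∈X , x∈Y))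

disjoint⁺ : (∀ {x} → x ∈ X → x ∉ Y) → Disjoint X Y
disjoint⁺ f (_ , p) = let x∈X , x∈Y = x∈p∩q⁻ _ _ p in f x∈X x∈Y

disjoint-sym : Disjoint X Y → Disjoint Y X
disjoint-sym d = disjoint⁺ (λ x∈Y x∈X → disjoint⁻ d x∈X x∈Y)

∪⁻ : x ∈ X ∪ Y → x ∈ X ⊎ x ∈ Y
∪⁻ = x∈p∪q⁻ _ _

∪ˡ : x ∈ X → x ∈ X ∪ Y
∪ˡ = p⊆p∪q _

∪ʳ : x ∈ Y → x ∈ X ∪ Y
∪ʳ = q⊆p∪q _ _

⁅⁆⁻ : ∀ {x y : Fin n} → x ∈ ⁅ y ⁆ → x ≡ y
⁅⁆⁻ = x∈⁅y⁆⇒x≡y _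

─⁻ : ∀ (X Y : Subset n) → x ∈ X ─ Y → x ∉ Y
─⁻ (_ ∷ X) (inside ∷ Y)  ()        here
─⁻ (_ ∷ X) (_ ∷ Y)       (there p) (there q) = ─⁻ X Y p q

supports⁺ : Any (λ t → x ∈ support t) ts → x ∈ supports ts
supports⁺ (here p)  = ∪ˡ p
supports⁺ (there p) = ∪ʳ (supports⁺ p)

supports⁻ : ∀ ts → x ∈ supports ts → Any (λ t → x ∈ support t) ts
supports⁻ []       p = ⊥-elim (∉⊥ p)
supports⁻ (t ∷ ts) p = [ here , there ∘ supports⁻ ts ]′ (∪⁻ p)

below-root : ∀ {r} ts → x ∈ support (node ⁅ r ⁆ ts) → x ≢ r → x ∈ supports ts
below-root _ x∈ x≢r = [ (λ x∈r → ⊥-elim (x≢r (⁅⁆⁻ x∈r))) , id ]′ (∪⁻ x∈)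

supports-++ : ∀ (ts : List (Tree n)) → supports (ts ++ us) ≡ supports ts ∪ supports us
supports-++ []       = sym (∪-identityˡ _)
supports-++ (t ∷ ts) = ≡.trans (cong (support t ∪_) (supports-++ ts)) (sym (∪-assoc _ _ _))

supports≡⋃ : ∀ (ts : List (Tree n)) → supports ts ≡ ⋃ (map support ts)
supports≡⋃ []       = refl
supports≡⋃ (t ∷ ts) = cong (support t ∪_) (supports≡⋃ ts)

-- Equality of non-planar trees

≈-refl : t ≈ t
≋-refl : Pointwise _≈_ ts ts

≈-refl {t = node X ts} = node (refl ≋-refl)

≋-refl {ts = []}     = []
≋-refl {ts = t ∷ ts} = ≈-refl ∷ ≋-refl

≈-trans : ∀ {v : Tree n} → t ≈ u → u ≈ v → t ≈ v
≈-trans (node p) (node q) = node (trans p q)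

≈-sym : t ≈ u → u ≈ t
≋-sym : Pointwise _≈_ ts us → Pointwise _≈_ us ts
↭-sym : Permutation _≈_ ts us → Permutation _≈_ us ts

≈-sym (node p) = node (↭-sym p)

≋-sym []       = []
≋-sym (e ∷ es) = ≈-sym e ∷ ≋-sym es

↭-sym (refl es)    = refl (≋-sym es)
↭-sym (prep e p)   = prep (≈-sym e) (↭-sym p)
↭-sym (swap d e p) = swap (≈-sym e) (≈-sym d) (↭-sym p)
↭-sym (trans p q)  = trans (↭-sym q) (↭-sym p)

treeSetoid : ℕ → Setoid 0ℓ 0ℓ
treeSetoid n = record
  { Carrier       = Tree n
  ; _≈_           = _≈_
  ; isEquivalence = record { refl = ≈-refl ; sym = ≈-sym ; trans = ≈-trans }
  }

module _ {n : ℕ} where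
  open SetoidPermutation (treeSetoid n) public using (_↭_; ↭-refl; ↭-prep; ↭-swap)
  open SetoidPermutationProperties (treeSetoid n) public
    using (All-resp-↭; Any-resp-↭; AllPairs-resp-↭; ++-comm; partition-↭)

-- The recursion through the lists nested in `Permutation` is carried out once, here. The step
-- receives the permutation with both relations: facts about supports need `≈` itself, while the
-- copy labelled by `R` holds the induction hypotheses.
≈-elim : ∀ {ℓ} (R : Rel (Tree n) ℓ) →
         (∀ {X ts us} → ts ↭ us → Permutation R ts us → R (node X ts) (node X us)) →
         ∀ {t u} → t ≈ u → R t u
≈-elim {n = n} R f = elim
  where
  elim  : ∀ {t u} → t ≈ u → R t u
  elim≋ : ∀ {ts us} → Pointwise _≈_ ts us → Pointwise R ts us
  elim↭ : ∀ {ts us} → ts ↭ us → Permutation R ts us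

  elim (node p) = f p (elim↭ p)

  elim≋ []       = []
  elim≋ (e ∷ es) = elim e ∷ elim≋ es

  elim↭ (refl es)    = refl (elim≋ es)
  elim↭ (prep e p)   = prep (elim e) (elim↭ p)
  elim↭ (swap d e p) = swap (elim d) (elim e) (elim↭ p)
  elim↭ (trans p q)  = trans (elim↭ p) (elim↭ q)

module _ {a p} {A : Set a} {P : Pred A p} where

  -- Each matched pair of entries brings its own implication. This is how the induction hypotheses
  -- of `≈-elim` are consumed, at a point where `P` is not yet known to respect `≈`.
  All-permute : ∀ {xs ys} → Permutation (λ x y → P x → P y) xs ys → All P xs → All P ys
  All-permute (refl fs)    ps           = go fs ps
    where
    go : ∀ {xs ys} → Pointwise (λ x y → P x → P y) xs ys → All P xs → All P ys
    go []       []       = []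
    go (f ∷ fs) (p ∷ ps) = f p ∷ go fs ps
  All-permute (prep f π)   (p ∷ ps)     = f p ∷ All-permute π ps
  All-permute (swap f g π) (p ∷ q ∷ ps) = g q ∷ f p ∷ All-permute π ps
  All-permute (trans π ρ)  ps           = All-permute ρ (All-permute π ps)

  Any-permute : ∀ {xs ys} → Permutation (λ x y → P x → P y) xs ys → Any P xs → Any P ys
  Any-permute (refl fs)    p                 = go fs p
    where
    go : ∀ {xs ys} → Pointwise (λ x y → P x → P y) xs ys → Any P xs → Any P ys
    go (f ∷ fs) (here p)  = here (f p)
    go (f ∷ fs) (there p) = there (go fs p)
  Any-permute (prep f π)   (here p)          = here (f p)
  Any-permute (prep f π)   (there p)         = there (Any-permute π p)
  Any-permute (swap f g π) (here p)          = there (here (f p))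
  Any-permute (swap f g π) (there (here p))  = here (g p)
  Any-permute (swap f g π) (there (there p)) = there (there (Any-permute π p))
  Any-permute (trans π ρ)  p                 = Any-permute ρ (Any-permute π p)

∈-support-resp : t ≈ u → x ∈ support t → x ∈ support u
∈-support-resp {x = x} = ≈-elim (λ t u → x ∈ support t → x ∈ support u) λ _ π →
  [ ∪ˡ , ∪ʳ ∘ supports⁺ ∘ Any-permute π ∘ supports⁻ _ ]′ ∘ ∪⁻

support-resp : t ≈ u → support t ≡ support u
support-resp e = ⊆-antisym (∈-support-resp e) (∈-support-resp (≈-sym e))

supports-resp : ts ↭ us → supports ts ≡ supports us
supports-resp π = ⊆-antisym (go π) (go (↭-sym π))
  where
  go : ∀ {ts us : List (Tree n)} → ts ↭ us → supports ts ⊆ supports us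
  go π = supports⁺ ∘ Any-resp-↭ ∈-support-resp π ∘ supports⁻ _

AllNodes-resp : ∀ {P : Pred (Subset n) 0ℓ} → t ≈ u → AllNodes P t → AllNodes P u
AllNodes-resp {P = P} = ≈-elim (λ t u → AllNodes P t → AllNodes P u) λ where
  _ π (node p ps) → node p (All-permute π ps)

bring-to-front : ∀ {P : Pred (Tree n) 0ℓ} → Any P ts → ∃₂ λ t us → P t × t ∈ˡ ts × ts ↭ t ∷ us
bring-to-front (here p) = _ , _ , p , here refl , ↭-refl
bring-to-front {ts = u ∷ _} (there q) =
  let t , us , p , t∈ , π = bring-to-front q
  in t , u ∷ us , p , there t∈ , trans (↭-prep u π) (↭-swap u t ↭-refl)

Tree-elim : ∀ {ℓ} (P : Pred (Tree n) ℓ) → (∀ {X ts} → All P ts → P (node X ts)) → ∀ t → P t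
Tree-elim {n = n} P f = elim
  where
  elim  : ∀ t → P t
  elims : ∀ ts → All P ts

  elim (node X ts) = f (elims ts)

  elims []       = []
  elims (t ∷ ts) = elim t ∷ elims ts

-- Tubes

-- For a construct `t` these sets form the nested set, or tubing, that `t` encodes.
data Tube {n} (X : Subset n) : Pred (Tree n) 0ℓ where
  here  : ∀ {t} → support t ≡ X → Tube X t
  there : ∀ {Y ts} → Any (Tube X) ts → Tube X (node Y ts)

tube⊆support   : Tube X t → X ⊆ support t
tubes⊆supports : Any (Tube X) ts → X ⊆ supports ts

tube⊆support (here refl) = id
tube⊆support (there p)   = ∪ʳ ∘ tubes⊆supports p

tubes⊆supports (here p)  = ∪ˡ ∘ tube⊆support p
tubes⊆supports (there p) = ∪ʳ ∘ tubes⊆supports p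

Tube-resp : t ≈ u → Tube X t → Tube X u
Tube-resp {X = X} = ≈-elim (λ t u → Tube X t → Tube X u) λ where
  π _ (here e)  → here (≡.trans (sym (support-resp (node π))) e)
  _ ρ (there p) → there (Any-permute ρ p)

Tubes-resp : ts ↭ us → Any (Tube X) ts → Any (Tube X) us
Tubes-resp = Any-resp-↭ Tube-resp

contracts-support : Contracts X Y t u → support u ≡ support t
contracts-support {X = X} {Y = Y} (here {us} {ts}) =
  ≡.trans (cong ((X ∪ Y) ∪_) (supports-++ us))
    (≡.trans (∪-assoc X Y _) (cong (X ∪_) (sym (∪-assoc Y (supports us) (supports ts)))))
contracts-support (there {Z} {ts = ts} c) = cong (λ S → Z ∪ (S ∪ supports ts)) (contracts-support c)

-- Valid trees and forests over a fixed hypergraph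

module Validity {n} (H : Hypergraph n) where

  -- `X` need not lie inside `C`, so the support of a whole tree can be tested against a smaller
  -- connected set, as in `connected⊆head`.
  Saturated : Subset n → Subset n → Set
  Saturated C X = ∀ {Z} → IsEdge H Z → Z ⊆ C → ∀ {x y} → x ∈ Z → y ∈ Z → x ∈ X → y ∈ X

  -- Equivalent to Connected (H ↾ C), but usable without forming the two parts of a partition.
  ConnectedSet : Subset n → Set
  ConnectedSet C = ∀ X → Saturated C X → ∀ {x y} → x ∈ C → y ∈ C → x ∈ X → y ∈ X

  -- IsConstruct with its two cases merged and the hypergraph of a subtree read off its support.
  data Valid  : Pred (Tree n) 0ℓ
  data Forest : Pred (List (Tree n)) 0ℓ

  data Valid where
    node : Nonempty X → Disjoint X (supports ts) → Forest ts → Valid (node X ts)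

  data Forest where
    forest : All Valid ts →
             All (ConnectedSet ∘ support) ts →
             AllPairs (Disjoint on support) ts →
             (∀ {Z} → IsEdge H Z → Z ⊆ supports ts → Any (λ t → Z ⊆ support t) ts) →
             Forest ts

  valid-nonempty : Valid t → Nonempty (support t)
  valid-nonempty (node (_ , x∈X) _ _) = _ , ∪ˡ x∈X

  tube-nonempty  : Valid t → Tube X t → Nonempty X
  tubes-nonempty : All Valid ts → Any (Tube X) ts → Nonempty X

  tube-nonempty v (here refl)                          = valid-nonempty v
  tube-nonempty (node _ _ (forest vs _ _ _)) (there p) = tubes-nonempty vs p

  tubes-nonempty (v ∷ _)  (here p)  = tube-nonempty v p
  tubes-nonempty (_ ∷ vs) (there p) = tubes-nonempty vs p

  -- Validity of the trees is passed as a function because it has two sources: the induction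
  -- hypotheses inside `valid-resp`, and `valid-resp` itself afterwards.
  forest-permute : ts ↭ us → (All Valid ts → All Valid us) → Forest ts → Forest us
  forest-permute π f (forest vs cs ds es) = forest (f vs)
    (All-resp-↭ (λ e → subst ConnectedSet (support-resp e)) π cs)
    (AllPairs-resp-↭ disjoint-sym
      ( (λ {X} e → subst (Disjoint (support X)) (support-resp e))
      , (λ {X} e → subst (λ S → Disjoint S (support X)) (support-resp e))) π ds)
    (λ {Z} e Z⊆ → Any-resp-↭ (λ e′ → subst (Z ⊆_) (support-resp e′)) π
      (es e (subst (Z ⊆_) (sym (supports-resp π)) Z⊆)))

  valid-resp : t ≈ u → Valid t → Valid u
  valid-resp = ≈-elim (λ t u → Valid t → Valid u) λ where
    π ρ (node ne d F) →
      node ne (subst (Disjoint _) (supports-resp π) d) (forest-permute π (All-permute ρ) F)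

  forest-resp : ts ↭ us → Forest ts → Forest us
  forest-resp π = forest-permute π (All-resp-↭ valid-resp π)

  forest-[] : Forest []
  forest-[] = forest [] [] [] λ e Z⊆⊥ → ⊥-elim (∉⊥ (Z⊆⊥ (proj₂ (edge-nonempty H e))))

  forest-valid : Forest ts → All Valid ts
  forest-valid (forest vs _ _ _) = vs

  disjoint-supports⁺ : All (λ u → Disjoint X (support u)) ts → Disjoint X (supports ts)
  disjoint-supports⁺ {ts = ts} ds = disjoint⁺ λ x∈X x∈ts →
    let d , x∈u = All.lookupAny ds (supports⁻ ts x∈ts) in disjoint⁻ d x∈X x∈u

  disjoint-supports⁻ : Disjoint X (supports ts) → All (λ u → Disjoint X (support u)) ts
  disjoint-supports⁻ d = All.tabulate λ u∈ → disjoint⁺ λ x∈X x∈u →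
    disjoint⁻ d x∈X (supports⁺ (lose u∈ x∈u))

  split-any : Any (λ t → Z ⊆ support t) ts → Z ⊆ supports ts
  split-any (here p)  = ∪ˡ ∘ p
  split-any (there p) = ∪ʳ ∘ split-any p

  forest-uncons : Forest (t ∷ ts) →
    Valid t × ConnectedSet (support t) × Disjoint (support t) (supports ts) × Forest ts
  forest-uncons {t} {ts} (forest (v ∷ vs) (c ∷ cs) (d ∷ ds) es) = v , c , D , forest vs cs ds es′
    where
    D : Disjoint (support t) (supports ts)
    D = disjoint-supports⁺ d
    es′ : IsEdge H Z → Z ⊆ supports ts → Any (λ t → Z ⊆ support t) ts
    es′ e Z⊆ with es e (∪ʳ ∘ Z⊆)
    ... | there p  = p
    -- Edges are non-empty, so one lying inside both `t` and `ts` would contradict their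
    -- disjointness.
    ... | here Z⊆t = let _ , z∈ = edge-nonempty H e in ⊥-elim (disjoint⁻ D (Z⊆t z∈) (Z⊆ z∈))

  forest-++ : ∀ {as bs} → Forest as → Forest bs → Disjoint (supports as) (supports bs) →
    (∀ {Z} → IsEdge H Z → Z ⊆ supports as ∪ supports bs → Z ⊆ supports as ⊎ Z ⊆ supports bs) →
    Forest (as ++ bs)
  forest-++ {as} {bs} (forest vs cs ds es) (forest vs′ cs′ ds′ es′) D split = forest
    (All.++⁺ vs vs′) (All.++⁺ cs cs′)
    (AllPairs.++⁺ ds ds′
      (All.map (disjoint-supports⁻ ∘ disjoint-sym) (disjoint-supports⁻ (disjoint-sym D))))
    (λ {Z} e Z⊆ → [ Any.++⁺ˡ ∘ (λ (p : Z ⊆ _) → es e p) , Any.++⁺ʳ as ∘ (λ (p : Z ⊆ _) → es′ e p) ]′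
      (split e (subst (Z ⊆_) (supports-++ as) Z⊆)))

  forest-∷ : Valid t → ConnectedSet (support t) → Disjoint (support t) (supports ts) → Forest ts →
    (∀ {Z} → IsEdge H Z → Z ⊆ supports (t ∷ ts) → Z ⊆ support t ⊎ Z ⊆ supports ts) →
    Forest (t ∷ ts)
  forest-∷ v c d (forest vs cs ds es) split =
    forest (v ∷ vs) (c ∷ cs) (disjoint-supports⁻ d ∷ ds)
      λ {Z} e Z⊆ → [ (λ (p : Z ⊆ _) → here p) , (λ (p : Z ⊆ _) → there (es e p)) ]′ (split e Z⊆)

  forest-++⁻ʳ : ∀ as {bs} → Forest (as ++ bs) → Forest bs
  forest-++⁻ʳ []       F = F
  forest-++⁻ʳ (a ∷ as) F = let _ , _ , _ , F′ = forest-uncons F in forest-++⁻ʳ as F′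

  forest-++⁻ˡ : ∀ as {bs} → Forest (as ++ bs) → Forest as
  forest-++⁻ˡ as {bs} F = forest-++⁻ʳ bs (forest-resp (++-comm as bs) F)

  forest-++-disjoint : ∀ as {bs} → Forest (as ++ bs) → Disjoint (supports as) (supports bs)
  forest-++-disjoint []       F = disjoint⁺ (λ x∈⊥ → ⊥-elim (∉⊥ x∈⊥))
  forest-++-disjoint (a ∷ as) F = disjoint⁺ λ x∈ x∈bs →
    let _ , _ , d , F′ = forest-uncons F in
    [ (λ x∈a → disjoint⁻ d x∈a (subst (_ ∈_) (sym (supports-++ as)) (∪ʳ x∈bs)))
    , (λ x∈as → disjoint⁻ (forest-++-disjoint as F′) x∈as x∈bs) ]′ (∪⁻ x∈)

  support-lookup : ∀ {P : Pred (Tree n) 0ℓ} (p : Any P ts) → support (Any.lookup p) ⊆ supports ts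
  support-lookup (here _)  = ∪ˡ
  support-lookup (there p) = ∪ʳ ∘ support-lookup p

  forest-split : Forest (t ∷ ts) → IsEdge H Z → Z ⊆ supports (t ∷ ts) →
                 Z ⊆ support t ⊎ Z ⊆ supports ts
  forest-split (forest _ _ _ es) e Z⊆ with es e Z⊆
  ... | here p  = inj₁ p
  ... | there p = inj₂ (split-any p)

  head-saturated : Forest (t ∷ ts) → Saturated (supports (t ∷ ts)) (support t)
  head-saturated F e Z⊆ x∈Z y∈Z x∈t with forest-split F e Z⊆
  ... | inj₁ Z⊆t  = Z⊆t y∈Z
  ... | inj₂ Z⊆ts =
    let _ , _ , d , _ = forest-uncons F in ⊥-elim (disjoint⁻ d x∈t (Z⊆ts x∈Z))

  -- No edge inside a forest crosses from one tree to another, so a connected set that meets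
  -- `support t` cannot leave it. In this sense the trees of a forest are maximal connected pieces.
  connected⊆head : Forest (t ∷ ts) → ConnectedSet X → X ⊆ supports (t ∷ ts) →
                   x ∈ X → x ∈ support t → X ⊆ support t
  connected⊆head {t} F c X⊆ x∈X x∈t y∈X =
    c (support t) (λ e Z⊆X → head-saturated F e (X⊆ ∘ Z⊆X)) x∈X y∈X x∈t

  -- Removing `Y` too breaks up only the component of `Y`: an edge that avoids `X ∪ Y` lies within
  -- `ts`, or in the subtree of `Y` and then within `us`.
  contract-valid : Valid (node X (node Y us ∷ ts)) → Valid (node (X ∪ Y) (us ++ ts))
  contract-valid {X} {Y} {us} {ts} (node (x , x∈X) d F)
    with forest-uncons F
  ... | node _ d′ Fus , _ , d″ , Fts = node (x , ∪ˡ x∈X) D (forest-++ Fus Fts us#ts split)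
    where
    us#ts : Disjoint (supports us) (supports ts)
    us#ts = disjoint⁺ (λ x∈ → disjoint⁻ d″ (∪ʳ x∈))
    D : Disjoint (X ∪ Y) (supports (us ++ ts))
    D = subst (Disjoint (X ∪ Y)) (sym (supports-++ us)) (disjoint⁺ λ x∈XY x∈ → [
        (λ x∈X → disjoint⁻ d x∈X ([ ∪ˡ ∘ ∪ʳ , ∪ʳ ]′ (∪⁻ x∈)))
      , (λ x∈Y → [ disjoint⁻ d′ x∈Y , disjoint⁻ d″ (∪ˡ x∈Y) ]′ (∪⁻ x∈)) ]′ (∪⁻ x∈XY))
    split : IsEdge H Z → Z ⊆ supports us ∪ supports ts → Z ⊆ supports us ⊎ Z ⊆ supports ts
    split e Z⊆ with forest-split F e ([ ∪ˡ ∘ ∪ʳ , ∪ʳ ]′ ∘ ∪⁻ ∘ Z⊆)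
    ... | inj₂ Z⊆ts = inj₂ Z⊆ts
    ... | inj₁ Z⊆Yus = inj₁ λ z∈ →
      [ id , (λ z∈ts → ⊥-elim (disjoint⁻ d″ (Z⊆Yus z∈) z∈ts)) ]′ (∪⁻ (Z⊆ z∈))

  valid-replace : Valid (node Z (t ∷ ts)) → Valid u → support u ≡ support t →
                  Valid (node Z (u ∷ ts))
  valid-replace {Z} {t} {ts} (node ne d (forest (_ ∷ vs) (c ∷ cs) (ds ∷ dss) es)) v eq = node ne
    (subst (λ S → Disjoint Z (S ∪ supports ts)) (sym eq) d)
    (forest (v ∷ vs) (subst ConnectedSet (sym eq) c ∷ cs)
      (subst (λ S → All (Disjoint S ∘ support) ts) (sym eq) ds ∷ dss)
      λ {Z} e Z⊆ → repl (es e (subst (λ S → Z ⊆ S ∪ supports ts) eq Z⊆)))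
    where
    repl : Any (λ t → Y ⊆ support t) (t ∷ ts) → Any (λ t → Y ⊆ support t) (_ ∷ ts)
    repl {Y} (here p)  = here (subst (Y ⊆_) (sym eq) p)
    repl (there p) = there p

  contracts-valid : Contracts X Y t u → Valid t → Valid u
  contracts-valid here      v = contract-valid v
  contracts-valid (there c) v@(node _ _ (forest (v′ ∷ _) _ _ _)) =
    valid-replace v (contracts-valid c v′) (contracts-support c)

  -- Grafting a vertex onto a forest

  module _ {r : Fin n} {L : List (Tree n)} where

    Touches : Pred (Tree n) 0ℓ
    Touches t = ∃ λ Z → IsEdge H Z × Z ⊆ ⁅ r ⁆ ∪ supports L × r ∈ Z × Nonempty (Z ∩ support t)

    touches? : Decidable Touches
    touches? t = anySubset? λ Z →
      isEdge? H Z ×-dec Z ⊆? (⁅ r ⁆ ∪ supports L) ×-dec r ∈? Z ×-dec nonempty? (Z ∩ support t)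

    -- The trees joined to `r` by an edge merge with `r` into one component and become the children
    -- of `r`; the other trees remain components of their own.
    graft : r ∉ supports L → Forest L →
            ∃₂ λ as bs → L ↭ as ++ bs × Forest (node ⁅ r ⁆ as ∷ bs)
    graft r∉L F = near , far , π , forest-∷ root-valid root-connected root#far F-far split
      where
      near far : List (Tree n)
      near = filter touches? L
      far  = filter (¬? ∘ touches?) L
      R : Subset n
      R = ⁅ r ⁆ ∪ supports near

      π : L ↭ near ++ far
      π = subst (λ p → L ↭ proj₁ p ++ proj₂ p) (partition-defn touches? L) (partition-↭ touches? L)
      supports-L : supports L ≡ supports near ∪ supports far
      supports-L = ≡.trans (supports-resp π) (supports-++ near)
      near⊆L : supports near ⊆ supports L
      near⊆L = subst (_ ∈_) (sym supports-L) ∘ ∪ˡ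
      far⊆L : supports far ⊆ supports L
      far⊆L = subst (_ ∈_) (sym supports-L) ∘ ∪ʳ

      F′ : Forest (near ++ far)
      F′ = forest-resp π F
      F-far : Forest far
      F-far = forest-++⁻ʳ near F′
      near#far : Disjoint (supports near) (supports far)
      near#far = forest-++-disjoint near F′

      root-valid : Valid (node ⁅ r ⁆ near)
      root-valid = node (r , x∈⁅x⁆ r)
        (disjoint⁺ λ x∈r x∈near → r∉L (near⊆L (subst (_∈ supports near) (⁅⁆⁻ x∈r) x∈near)))
        (forest-++⁻ˡ near F′)

      root#far : Disjoint R (supports far)
      root#far = disjoint⁺ λ x∈R x∈far →
        [ (λ x∈r → r∉L (far⊆L (subst (_∈ supports far) (⁅⁆⁻ x∈r) x∈far)))
        , (λ x∈near → disjoint⁻ near#far x∈near x∈far) ]′ (∪⁻ x∈R)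

      edge-at-r : IsEdge H Z → r ∈ Z → Z ⊆ R ∪ supports far → Z ⊆ R
      edge-at-r {Z} e r∈Z Z⊆ z∈Z with ∪⁻ (Z⊆ z∈Z)
      ... | inj₁ z∈R   = z∈R
      ... | inj₂ z∈far =
        -- An edge through `r` that reached a far tree would make that tree touch `r`.
        let ¬touch , z∈t = All.lookupAny (All.all-filter (¬? ∘ touches?) L) (supports⁻ far z∈far)
        in ⊥-elim (¬touch (Z , e , Z⊆rL , r∈Z , _ , x∈p∩q⁺ (z∈Z , z∈t)))
        where
        Z⊆rL : Z ⊆ ⁅ r ⁆ ∪ supports L
        Z⊆rL z∈ = [ [ ∪ˡ , ∪ʳ ∘ near⊆L ]′ ∘ ∪⁻ , ∪ʳ ∘ far⊆L ]′ (∪⁻ (Z⊆ z∈))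

      edge-off-r : r ∉ Z → Z ⊆ R ∪ supports far → Z ⊆ supports near ∪ supports far
      edge-off-r {Z} r∉Z Z⊆ z∈ =
        [ [ (λ z∈r → ⊥-elim (r∉Z (subst (_∈ Z) (⁅⁆⁻ z∈r) z∈))) , ∪ˡ ]′ ∘ ∪⁻ , ∪ʳ ]′ (∪⁻ (Z⊆ z∈))

      split : IsEdge H Z → Z ⊆ R ∪ supports far → Z ⊆ R ⊎ Z ⊆ supports far
      split {Z} e Z⊆ with r ∈? Z | F′
      ... | yes r∈Z | _ = inj₁ (edge-at-r e r∈Z Z⊆)
      ... | no  r∉Z | forest _ _ _ es
        with Any.++⁻ near (es e (subst (Z ⊆_) (sym (supports-++ near)) (edge-off-r r∉Z Z⊆)))
      ... | inj₁ p = inj₁ (∪ʳ ∘ split-any p)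
      ... | inj₂ p = inj₂ (split-any p)

      -- Each near tree is connected and shares a vertex with an edge through `r`. Membership in `X`
      -- therefore travels from any vertex to `r`, and from `r` to any other vertex.
      root-connected : ConnectedSet R
      root-connected X sat x∈R y∈R x∈X = from-r (to-r x∈R x∈X) y∈R
        where
        Linked : Pred (Subset n) 0ℓ
        Linked S = S ⊆ R × ConnectedSet S ×
          ∃ λ Z → IsEdge H Z × Z ⊆ R × r ∈ Z × ∃ λ w → w ∈ Z × w ∈ S

        linked : ∀ {x} → x ∈ supports near → ∃ λ S → x ∈ S × Linked S
        linked x∈near with forest-++⁻ˡ near F′
        ... | forest _ cs _ _ =
          let p = supports⁻ near x∈near
              c , x∈t = All.lookupAny cs p
              (Z , e , Z⊆ , r∈Z , w , w∈) , _ = All.lookupAny (All.all-filter touches? L) p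
              w∈Z , w∈t = x∈p∩q⁻ _ _ w∈
              Z⊆rnf = λ {z} z∈ →
                [ ∪ˡ ∘ ∪ˡ , [ ∪ˡ ∘ ∪ʳ , ∪ʳ ]′ ∘ ∪⁻ ∘ subst (z ∈_) supports-L ]′ (∪⁻ (Z⊆ z∈))
          in _ , x∈t , ∪ʳ ∘ support-lookup p , c , Z , e , edge-at-r e r∈Z Z⊆rnf , r∈Z ,
             w , w∈Z , w∈t

        sat-in : ∀ {S} → S ⊆ R → Saturated S X
        sat-in S⊆R e Z⊆S = sat e (S⊆R ∘ Z⊆S)

        to-r : ∀ {x} → x ∈ R → x ∈ X → r ∈ X
        to-r x∈R x∈X with ∪⁻ x∈R
        ... | inj₁ x∈r = subst (_∈ X) (⁅⁆⁻ x∈r) x∈X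
        ... | inj₂ x∈near =
          let S , x∈S , S⊆R , c , Z , e , Z⊆R , r∈Z , w , w∈Z , w∈S = linked x∈near
          in sat e Z⊆R w∈Z r∈Z (c X (sat-in S⊆R) x∈S w∈S x∈X)

        from-r : ∀ {y} → r ∈ X → y ∈ R → y ∈ X
        from-r r∈X y∈R with ∪⁻ y∈R
        ... | inj₁ y∈r = subst (_∈ X) (sym (⁅⁆⁻ y∈r)) r∈X
        ... | inj₂ y∈near =
          let S , y∈S , S⊆R , c , Z , e , Z⊆R , r∈Z , w , w∈Z , w∈S = linked y∈near
          in c X (sat-in S⊆R) w∈S y∈S (sat e Z⊆R r∈Z w∈Z r∈X)

  -- Comparison of valid trees with constructs

  -- Restrictions pile up along the recursion of `IsConstruct`. Knowing that `K` has exactly the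
  -- edges of `H` within its vertices lets connectedness in every such `K` be measured in the one
  -- hypergraph `H`.
  Induced : Hypergraph n → Set
  Induced K = ∀ {Z} → (IsEdge K Z → IsEdge H Z) × (IsEdge H Z → Z ⊆ vertices K → IsEdge K Z)

  self-induced : Induced H
  self-induced = id , λ e _ → e

  ↾-induced : ∀ K → Induced K → Induced (K ↾ X)
  ↾-induced K ind = proj₁ ind ∘ proj₁ , λ e Z⊆ →
    proj₂ ind e (proj₁ ∘ x∈p∩q⁻ _ _ ∘ Z⊆) , proj₂ ∘ x∈p∩q⁻ _ _ ∘ Z⊆

  connected⇒connectedSet : ∀ K → Induced K → Connected K → ConnectedSet (vertices K)
  connected⇒connectedSet K ind conn X sat {x} {y} x∈ y∈ x∈X with y ∈? X
  ... | yes y∈X = y∈X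
  -- Otherwise `X` cuts the vertices into two parts, inhabited by `x` and `y`, and saturation puts
  -- every edge into one of them.
  ... | no  y∉X = ⊥-elim (conn (V ∩ X) (V ─ X)
      (x , x∈p∩q⁺ (x∈ , x∈X)) (y , x∈p∧x∉q⇒x∈p─q y∈ y∉X)
      (disjoint⁺ λ z∈V∩X z∈V─X → ─⁻ V X z∈V─X (proj₂ (x∈p∩q⁻ V X z∈V∩X)))
      (⊆-antisym
        (λ z∈ → [ p∩q⊆p V X , p─q⊆p V X ]′ (∪⁻ z∈))
        union)
      (parts , λ {Z} → [ proj₁ , proj₁ ]′))
    where
    V = vertices K
    union : V ⊆ (V ∩ X) ∪ (V ─ X)
    union {z} z∈V with z ∈? X
    ... | yes z∈X = ∪ˡ (x∈p∩q⁺ (z∈V , z∈X))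
    ... | no  z∉X = ∪ʳ (x∈p∧x∉q⇒x∈p─q z∈V z∉X)
    parts : IsEdge K Z → IsEdge (K ↾ (V ∩ X)) Z ⊎ IsEdge (K ↾ (V ─ X)) Z
    parts {Z} e with z , z∈Z ← edge-nonempty K e with z ∈? X
    ... | yes z∈X = inj₁ (e , λ w∈Z → x∈p∩q⁺
      (edge⊆vertices K e w∈Z , sat (proj₁ ind e) (edge⊆vertices K e) z∈Z w∈Z z∈X))
    ... | no  z∉X = inj₂ (e , λ w∈Z → x∈p∧x∉q⇒x∈p─q
      (edge⊆vertices K e w∈Z) (z∉X ∘ sat (proj₁ ind e) (edge⊆vertices K e) w∈Z z∈Z))

  connectedSet⇒connected : ∀ K → Induced K → ConnectedSet (vertices K) → Connected K
  connectedSet⇒connected K ind conn X₁ X₂ (x , x∈) (y , y∈) d eq (parts , _) =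
    disjoint⁻ d (conn X₁ sat (subst (x ∈_) eq (∪ˡ x∈)) (subst (y ∈_) eq (∪ʳ y∈)) x∈) y∈
    where
    sat : Saturated (vertices K) X₁
    sat e Z⊆ a∈Z b∈Z a∈X₁ with parts (proj₂ ind e Z⊆)
    ... | inj₁ (_ , Z⊆X₁) = Z⊆X₁ b∈Z
    ... | inj₂ (_ , Z⊆X₂) = ⊥-elim (disjoint⁻ d a∈X₁ (Z⊆X₂ a∈Z))

  ∩-absorb : X ⊆ Y → Y ∩ X ≡ X
  ∩-absorb X⊆Y = ⊆-antisym (p∩q⊆q _ _) (λ x∈ → x∈p∩q⁺ (X⊆Y x∈ , x∈))

  -- The clauses of `Forest` are those of `Components` for the list of supports; non-emptiness comes
  -- from validity, and covering is the equation on `supports ts`.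
  components⁺ : ∀ K → Induced K → Forest ts → supports ts ≡ vertices K →
                Components K (map support ts)
  components⁺ {ts} K ind (forest vs cs ds es) eq = record
    { nonempty  = All.map⁺ (All.map valid-nonempty vs)
    ; disjoint  = AllPairs.map⁺ ds
    ; covers    = ≡.trans (sym (supports≡⋃ ts)) eq
    ; connected = All.map⁺ (All.tabulate λ t∈ → connectedSet⇒connected (K ↾ _) (↾-induced K ind)
        (subst ConnectedSet (sym (∩-absorb (subst (_ ∈_) eq ∘ λ x∈ → supports⁺ (lose t∈ x∈))))
          (All.lookup cs t∈)))
    ; edges     =
        (λ {Z} e → Any.map⁺ (Any.map (λ Z⊆t → e , λ {x} → Z⊆t {x})
          (es (proj₁ ind e) (subst (Z ⊆_) (sym eq) (edge⊆vertices K e)))))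
      , (λ {Z} p → let _ , e , _ = Any.satisfied p in e)
    }

  components⁻ : ∀ K → Induced K → Components K (map support ts) → All Valid ts →
                Forest ts × supports ts ≡ vertices K
  components⁻ {ts} K ind comps vs = forest vs
      (All.tabulate λ t∈ → subst ConnectedSet (∩-absorb (t⊆ t∈))
        (connected⇒connectedSet (K ↾ _) (↾-induced K ind) (All.lookup (All.map⁻ connected) t∈)))
      (AllPairs.map⁻ disjoint)
      (λ {Z} e Z⊆ → Any.map proj₂
        (Any.map⁻ (proj₁ edges (proj₂ ind e (subst (Z ⊆_) eq Z⊆)))))
    , eq
    where
    open Components comps
    eq : supports ts ≡ vertices K
    eq = ≡.trans (supports≡⋃ ts) covers
    t⊆ : t ∈ˡ ts → support t ⊆ vertices K
    t⊆ t∈ = subst (_ ∈_) eq ∘ λ x∈ → supports⁺ (lose t∈ x∈)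

  vertices-∖ : ∀ (K : Hypergraph n) → vertices K ≡ X ∪ Y → Disjoint X Y → vertices (K ∖ X) ≡ Y
  vertices-∖ {X} {Y} K eq d = ⊆-antisym
    (λ z∈ → let z∈V , z∈V─X = x∈p∩q⁻ _ _ z∈ in
      [ (λ z∈X → ⊥-elim (─⁻ (vertices K) X z∈V─X z∈X)) , id ]′ (∪⁻ (subst (_ ∈_) eq z∈V)))
    (λ z∈Y → let z∈V = subst (_ ∈_) (sym eq) (∪ʳ z∈Y) in
      x∈p∩q⁺ (z∈V , x∈p∧x∉q⇒x∈p─q z∈V (λ z∈X → disjoint⁻ d z∈X z∈Y)))

  -- The mutual statement also identifies the list `Cs` stored in `branch` with the supports of the
  -- children, which is the form that `components⁻` accepts.
  construct⇒valid  : ∀ K → Induced K → IsConstruct K t → Valid t × support t ≡ vertices K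
  constructs⇒valid : ∀ K {Cs} → Induced K → All (_⊆ vertices K) Cs →
    Pointwise (λ C t → IsConstruct (K ↾ C) t) Cs ts → All Valid ts × map support ts ≡ Cs

  construct⇒valid K ind (leaf ne) =
    node ne (disjoint⁺ (λ _ → ∉⊥)) forest-[] , ∪-identityʳ _
  construct⇒valid K ind (branch {Y} {Cs} {ts} ne (Y⊆V , _) comps pw) =
    let vs , eq = constructs⇒valid K ind (All.tabulate C⊆V) pw
        F , sup = components⁻ (K ∖ Y) (↾-induced K ind)
          (subst (Components (K ∖ Y)) (sym eq) comps) vs
    in node ne
         (disjoint⁺ λ x∈Y x∈ts →
           ─⁻ V Y (proj₂ (x∈p∩q⁻ V (V ─ Y) (subst (_ ∈_) sup x∈ts))) x∈Y)
         F
     , ⊆-antisym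
         (λ x∈ → [ Y⊆V , (λ x∈ts → p∩q⊆p V (V ─ Y) (subst (_ ∈_) sup x∈ts)) ]′ (∪⁻ x∈))
         (λ {x} x∈V → cover sup x∈V)
    where
    V = vertices K
    cover : supports ts ≡ V ∩ (V ─ Y) → V ⊆ Y ∪ supports ts
    cover sup {x} x∈V with x ∈? Y
    ... | yes x∈Y = ∪ˡ x∈Y
    ... | no  x∉Y = ∪ʳ (subst (x ∈_) (sym sup) (x∈p∩q⁺ (x∈V , x∈p∧x∉q⇒x∈p─q x∈V x∉Y)))
    ∈⋃ : ∀ {C Cs} → C ∈ˡ Cs → x ∈ C → x ∈ ⋃ Cs
    ∈⋃ (here refl) = ∪ˡ
    ∈⋃ (there C∈)  = ∪ʳ ∘ ∈⋃ C∈
    C⊆V : ∀ {C} → C ∈ˡ Cs → C ⊆ V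
    C⊆V C∈ = p∩q⊆p V (V ─ Y) ∘ subst (_ ∈_) (Components.covers comps) ∘ ∈⋃ C∈

  constructs⇒valid K ind []         []       = [] , refl
  constructs⇒valid K ind (C⊆ ∷ Cs⊆) (c ∷ cs) =
    let v , eq   = construct⇒valid (K ↾ _) (↾-induced K ind) c
        vs , eqs = constructs⇒valid K ind Cs⊆ cs
    in v ∷ vs , cong₂ _∷_ (≡.trans eq (∩-absorb C⊆)) eqs

  -- The list of children decides the case: an empty one gives `leaf`, and otherwise a vertex of the
  -- first child shows that the root label is a proper subset.
  valid⇒construct  : ∀ K → Induced K → Valid t → support t ≡ vertices K → IsConstruct K t
  valids⇒constructs : ∀ K → Induced K → All Valid ts → supports ts ⊆ vertices K →
    Pointwise (λ C t → IsConstruct (K ↾ C) t) (map support ts) ts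

  valid⇒construct K ind (node {X} {[]} (x , x∈X) _ _) eq =
    subst (λ S → IsConstruct K (node S [])) (sym X≡V) (leaf (x , subst (x ∈_) X≡V x∈X))
    where
    X≡V : X ≡ vertices K
    X≡V = ≡.trans (sym (∪-identityʳ X)) eq
  valid⇒construct K ind (node {X} {ts@(_ ∷ _)} ne d F@(forest (v ∷ vs) _ _ _)) eq =
    branch ne
      (subst (_ ∈_) eq ∘ ∪ˡ
        , let y , y∈t = valid-nonempty v
          in y , subst (y ∈_) eq (∪ʳ (∪ˡ y∈t)) , λ y∈X → disjoint⁻ d y∈X (∪ˡ y∈t))
      (components⁺ (K ∖ X) (↾-induced K ind) F (sym (vertices-∖ K (sym eq) d)))
      (valids⇒constructs K ind (v ∷ vs) (subst (_ ∈_) eq ∘ ∪ʳ))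

  valids⇒constructs K ind []       _   = []
  valids⇒constructs K ind (v ∷ vs) ts⊆ =
    valid⇒construct (K ↾ _) (↾-induced K ind) v (sym (∩-absorb (ts⊆ ∘ ∪ˡ)))
    ∷ valids⇒constructs K ind vs (ts⊆ ∘ ∪ʳ)

-- Filtered children, and flips seen as contractions

↭-filter : ∀ {P : Pred (Tree n) 0ℓ} (P? : Decidable P) → P Respects _≈_ →
           ts ↭ us → filter P? ts ↭ filter P? us
↭-filter P? resp = SetoidPermutationProperties.filter⁺ (treeSetoid _) P? resp

⊆-filters : ∀ (K : Subset n) → All (λ t → support t ⊆ K) ts → All (λ t → ¬ support t ⊆ K) us →
  filter (λ t → support t ⊆? K) (ts ++ us) ≡ ts
  × filter (λ t → ¬? (support t ⊆? K)) (ts ++ us) ≡ us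
⊆-filters {ts = ts} {us} K ins outs =
    ≡.trans (filter-++ in? ts us)
      (≡.trans (cong₂ _++_ (filter-all in? ins) (filter-none in? outs)) (++-identityʳ ts))
  , ≡.trans (filter-++ (¬? ∘ in?) ts us)
      (cong₂ _++_ (filter-none (¬? ∘ in?) (All.map (λ p ¬p → ¬p p) ins))
                  (filter-all (¬? ∘ in?) outs))
  where
  in? = λ t → support t ⊆? K

≈-node : X ≡ Y → ts ↭ us → node X ts ≈ node Y us
≈-node refl = node

-- Contracting the edge before or after the flip merges the same two labels over the same subtrees
-- `as ++ bs`; the filters only reorder these.
flip-contracts : ∀ {H : Hypergraph n} {x y} → Flips H x y t u →
  ∃₂ λ v w → Contracts ⁅ x ⁆ ⁅ y ⁆ t v × Contracts ⁅ y ⁆ ⁅ x ⁆ u w × w ≈ v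
flip-contracts (here {as} {bs} {K} _ _) = _ , _ , here , here ,
  ≈-node (∪-comm ⁅ _ ⁆ ⁅ _ ⁆)
    (↭-sym (subst (λ p → as ++ bs ↭ proj₁ p ++ proj₂ p) (partition-defn in? (as ++ bs))
      (partition-↭ in? (as ++ bs))))
  where
  in? = λ t → support t ⊆? K
flip-contracts (there f) =
  let _ , _ , c , d , e = flip-contracts f in _ , _ , there c , there d , node (prep e ↭-refl)

-- The flip order on valid constructions

module Flipping {n} (𝐇 : OrderedHypergraph n) where
  open OrderedHypergraph 𝐇 renaming (hypergraph to H)
  open IsTotalOrder isTotalOrder using (antisym)
    renaming (reflexive to ≤-reflexive; trans to ≤-trans)
  open Validity H

  Singletons : Pred (Tree n) 0ℓ
  Singletons = AllNodes IsSingleton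

  ValidConstruction : Pred (Tree n) 0ℓ
  ValidConstruction t = Valid t × Singletons t

  infix 4 _⇝_ _≼_
  -- The common support need not be the whole vertex set, so flips can be made inside a subtree and
  -- lifted by `⇝-child`.
  _⇝_ : Rel (Tree n) 0ℓ
  t ⇝ u = ValidConstruction t × ValidConstruction u × support t ≡ support u ×
          ∃₂ λ x y → y < x × FlipsTo H t x y u

  _≼_ : Rel (Tree n) 0ℓ
  t ≼ u = t ≈ u ⊎ TransClosure _⇝_ t u

  validConstruction-resp : t ≈ u → ValidConstruction t → ValidConstruction u
  validConstruction-resp e (v , s) = valid-resp e v , AllNodes-resp e s

  ⇝-respˡ : ∀ {v} → t ≈ u → u ⇝ v → t ⇝ v
  ⇝-respˡ e (cu , cv , eq , x , y , y<x , S , T , e₁ , f , e₂) =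
    validConstruction-resp (≈-sym e) cu , cv , ≡.trans (support-resp e) eq ,
    x , y , y<x , S , T , ≈-trans e e₁ , f , e₂

  ⇝-respʳ : ∀ {v} → t ⇝ u → u ≈ v → t ⇝ v
  ⇝-respʳ (ct , cu , eq , x , y , y<x , S , T , e₁ , f , e₂) e =
    ct , validConstruction-resp e cu , ≡.trans eq (support-resp e) ,
    x , y , y<x , S , T , e₁ , f , ≈-trans e₂ e

  ⇝⁺-respˡ : ∀ {v} → t ≈ u → TransClosure _⇝_ u v → TransClosure _⇝_ t v
  ⇝⁺-respˡ e [ s ]    = [ ⇝-respˡ e s ]
  ⇝⁺-respˡ e (s ∷ ss) = ⇝-respˡ e s ∷ ss

  ⇝⁺-respʳ : ∀ {v} → TransClosure _⇝_ t u → u ≈ v → TransClosure _⇝_ t v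
  ⇝⁺-respʳ [ s ]    e = [ ⇝-respʳ s e ]
  ⇝⁺-respʳ (s ∷ ss) e = s ∷ ⇝⁺-respʳ ss e

  ≼-trans : ∀ {v} → t ≼ u → u ≼ v → t ≼ v
  ≼-trans (inj₁ e)  (inj₁ e′) = inj₁ (≈-trans e e′)
  ≼-trans (inj₁ e)  (inj₂ ss) = inj₂ (⇝⁺-respˡ e ss)
  ≼-trans (inj₂ ss) (inj₁ e)  = inj₂ (⇝⁺-respʳ ss e)
  ≼-trans (inj₂ rs) (inj₂ ss) = inj₂ (rs TransClosure.++ ss)

  ≼-⇝-trans : ∀ {v} → t ≼ u → u ⇝ v → TransClosure _⇝_ t v
  ≼-⇝-trans (inj₁ e)  s = [ ⇝-respˡ e s ]
  ≼-⇝-trans (inj₂ ss) s = ss TransClosure.∷ʳ s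

  ⇝⁺-support : TransClosure _⇝_ t u → support t ≡ support u
  ⇝⁺-support [ _ , _ , eq , _ ]        = eq
  ⇝⁺-support ((_ , _ , eq , _) ∷ ss) = ≡.trans eq (⇝⁺-support ss)

  ≼-support : t ≼ u → support t ≡ support u
  ≼-support (inj₁ e)  = support-resp e
  ≼-support (inj₂ ss) = ⇝⁺-support ss

  replace-child : ValidConstruction (node Z (t ∷ ts)) → ValidConstruction u →
                  support u ≡ support t → ValidConstruction (node Z (u ∷ ts))
  replace-child (v , node s (_ ∷ ss)) (v′ , s′) eq = valid-replace v v′ eq , node s (s′ ∷ ss)

  ⇝-child : ValidConstruction (node Z (t ∷ ts)) → t ⇝ u → node Z (t ∷ ts) ⇝ node Z (u ∷ ts)
  ⇝-child {Z} {ts = ts} vc (_ , cu , eq , x , y , y<x , _ , _ , e , f , e′) =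
    vc , replace-child vc cu (sym eq) , cong (λ S → Z ∪ (S ∪ supports ts)) eq ,
    x , y , y<x , _ , _ , node (prep e ↭-refl) , there f , node (prep e′ ↭-refl)

  ≼-child : ValidConstruction (node Z (t ∷ ts)) → t ≼ u → node Z (t ∷ ts) ≼ node Z (u ∷ ts)
  ≼-child vc (inj₁ e)  = inj₁ (node (prep e ↭-refl))
  ≼-child {Z} {ts = ts} vc (inj₂ ss) = inj₂ (go vc ss)
    where
    go : ∀ {t u} → ValidConstruction (node Z (t ∷ ts)) → TransClosure _⇝_ t u →
         TransClosure _⇝_ (node Z (t ∷ ts)) (node Z (u ∷ ts))
    go vc [ s ]                         = [ ⇝-child vc s ]
    go vc (s@(_ , cu , eq , _) ∷ ss) =
      ⇝-child vc s ∷ go (replace-child vc cu (sym eq)) ss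

  -- Undoing a flip

  contract-tubes : Tube Z (node X (node Y us ∷ ts)) →
                   Z ≡ support (node Y us) ⊎ Tube Z (node (X ∪ Y) (us ++ ts))
  contract-tubes {X = X} {Y} {us} {ts} (here e) =
    inj₂ (here (≡.trans (contracts-support {X = X} {Y} (here {us = us} {ts})) e))
  contract-tubes (there (here (here e)))  = inj₁ (sym e)
  contract-tubes (there (here (there p))) = inj₂ (there (Any.++⁺ˡ p))
  contract-tubes {us = us} (there (there p))       = inj₂ (there (Any.++⁺ʳ us p))

  uncontract-tubes : Tube Z (node (X ∪ Y) (us ++ ts)) → Tube Z (node X (node Y us ∷ ts))
  uncontract-tubes {X = X} {Y} {us} {ts} (here e) =
    here (≡.trans (sym (contracts-support {X = X} {Y} (here {us = us} {ts}))) e)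
  uncontract-tubes {us = us} (there p) with Any.++⁻ us p
  ... | inj₁ q = there (here (there q))
  ... | inj₂ q = there (there q)

  -- Contract the edge and graft `r` onto the resulting forest, leaving `m` on top. Flipping back,
  -- the component that contains `m` is the support of `node ⁅ m ⁆ cs`, so the filters sort the
  -- subtrees into `cs` and `ds` again. Only the tube of `m` can get lost.
  unflip : ∀ {r m cs ds} → ValidConstruction (node ⁅ r ⁆ (node ⁅ m ⁆ cs ∷ ds)) → r < m →
    support (node ⁅ r ⁆ (node ⁅ m ⁆ cs ∷ ds)) ⊆ vertices H →
    ∃ λ us → node ⁅ m ⁆ us ⇝ node ⁅ r ⁆ (node ⁅ m ⁆ cs ∷ ds)
      × (∀ {X} → Tube X (node (⁅ r ⁆ ∪ ⁅ m ⁆) (cs ++ ds)) → Tube X (node ⁅ m ⁆ us))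
  unflip {r} {m} {cs} {ds} (v@(node _ r#B F) , node _ (node _ scs ∷ sds)) r<m B⊆V
    with contract-valid v
  ... | node _ rm# FL
    with graft (disjoint⁻ rm# (∪ˡ (x∈⁅x⁆ r))) FL
  ... | as , bs , π , FM =
    node ⁅ r ⁆ as ∷ bs
    , ( (M-valid , M-singletons) , (v , node (r , refl) (node (m , refl) scs ∷ sds)) , supM≡supB
      , m , r , r<m , _ , _ , ≈-refl , here comp (∪ˡ (x∈⁅x⁆ m)) , flipped)
    , tubes
    where
    B = node ⁅ r ⁆ (node ⁅ m ⁆ cs ∷ ds)
    M = node ⁅ m ⁆ (node ⁅ r ⁆ as ∷ bs)
    K = support (node ⁅ m ⁆ cs)
    in? = λ t → support t ⊆? K

    supM≡supB : support M ≡ support B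
    supM≡supB =
      ≡.trans (sym (contracts-support {X = ⁅ m ⁆} {⁅ r ⁆} (here {us = as} {bs})))
        (≡.trans (cong₂ _∪_ (∪-comm ⁅ m ⁆ ⁅ r ⁆) (sym (supports-resp π)))
          (contracts-support {X = ⁅ r ⁆} {⁅ m ⁆} (here {us = cs} {ds})))

    m∉ : m ∉ support (node ⁅ r ⁆ as) ∪ supports bs
    m∉ m∈ = [ [ (λ m∈r → proj₂ r<m (sym (⁅⁆⁻ m∈r))) , off-L ∘ ∪ˡ ]′ ∘ ∪⁻ , off-L ∘ ∪ʳ ]′ (∪⁻ m∈)
      where
      off-L : m ∉ supports as ∪ supports bs
      off-L m∈ = disjoint⁻ rm# (∪ʳ (x∈⁅x⁆ m))
        (subst (m ∈_) (sym (≡.trans (supports-resp π) (supports-++ as))) m∈)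

    M-valid : Valid M
    M-valid = node (m , x∈⁅x⁆ m) (disjoint⁺ λ x∈m x∈ → m∉ (subst (_∈ _) (⁅⁆⁻ x∈m) x∈)) FM

    M-singletons : Singletons M
    M-singletons with All-resp-↭ AllNodes-resp π (All.++⁺ scs sds)
    ... | ss = node (m , refl) (node (r , refl) (All.++⁻ˡ as ss) ∷ All.++⁻ʳ as ss)

    -- The children of `B` already list the components left when `r` is removed, and `K` is the
    -- first of them.
    comp : IsComponent ((H ↾ support M) ∖ ⁅ r ⁆) K
    comp = _ , components⁺ ((H ↾ support M) ∖ ⁅ r ⁆)
      (↾-induced (H ↾ support M) (↾-induced H self-induced)) F
      (sym (vertices-∖ (H ↾ support M)
        (≡.trans (cong (vertices H ∩_) supM≡supB) (∩-absorb B⊆V)) r#B)) , here refl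

    in-resp : (λ t → support t ⊆ K) Respects _≈_
    in-resp e = subst (_⊆ K) (support-resp e)

    ds-⊈K : t ∈ˡ ds → ¬ support t ⊆ K
    ds-⊈K t∈ t⊆K =
      let _ , _ , d , F-ds = forest-uncons F
          _ , x∈t = valid-nonempty (All.lookup (forest-valid F-ds) t∈)
      in disjoint⁻ d (t⊆K x∈t) (supports⁺ (lose t∈ x∈t))

    flipped : node ⁅ r ⁆ (node ⁅ m ⁆ (filter in? (as ++ bs)) ∷ filter (¬? ∘ in?) (as ++ bs)) ≈ B
    flipped with ⊆-filters {ts = cs} {ds} K
      (All.tabulate λ t∈ x∈t → ∪ʳ (supports⁺ (lose t∈ x∈t))) (All.tabulate ds-⊈K)
    ... | eq-in , eq-out = node (prep
        (node (subst (filter in? (as ++ bs) ↭_) eq-in (↭-filter in? in-resp (↭-sym π))))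
        (subst (filter (¬? ∘ in?) (as ++ bs) ↭_) eq-out
          (↭-filter (¬? ∘ in?) (λ e ¬p p → ¬p (in-resp (≈-sym e) p)) (↭-sym π))))

    tubes : Tube X (node (⁅ r ⁆ ∪ ⁅ m ⁆) (cs ++ ds)) → Tube X M
    tubes (here e) = here (≡.trans supM≡supB
      (≡.trans (sym (contracts-support {X = ⁅ r ⁆} {⁅ m ⁆} (here {us = cs} {ds}))) e))
    tubes (there p) with Any.++⁻ as (Tubes-resp π p)
    ... | inj₁ q = there (here (there q))
    ... | inj₂ q = there (there q)

  -- Recovering the tube lost in a fusion

  -- The edge from U to V is contracted; D is the tube of V, and G that of U and of U ∪ V.
  module Pull {U V D G : Subset n} (V<U : ∀ {u v} → u ∈ U → v ∈ V → v < u) where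

    -- Undoing a flip of `m ∈ U` over `r ∈ V` can destroy only a tube that contains `m` but not `r`.
    -- Stable sets are never of this kind, and all tubes of the contracted tree are stable.
    Stable : Subset n → Set
    Stable X = ∀ {u} → u ∈ U → u ∈ X → V ⊆ X

    stable-disjoint : Disjoint U X → Stable X
    stable-disjoint d u∈U u∈X = ⊥-elim (disjoint⁻ d u∈U u∈X)

    Lowering : Tree n → Pred (Tree n) 0ℓ → Set
    Lowering t P = ∃ λ s → ValidConstruction s × s ≼ t ×
                   (∀ {X} → Stable X → Tube X t → Tube X s) × P s

    lowering-trans : ∀ {P Q} → Lowering t P → (∀ {s} → ValidConstruction s → s ≼ t →
      (∀ {X} → Stable X → Tube X t → Tube X s) → P s → Lowering s Q) → Lowering t Q
    lowering-trans (s , vs , s≼t , keep , p) f =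
      let r , vr , r≼s , keep′ , q = f vs s≼t keep p
      in r , vr , ≼-trans r≼s s≼t , (λ st → keep′ st ∘ keep st) , q

    lower-child : ∀ {P} → ValidConstruction (node X ts) → ts ↭ u ∷ us → Lowering u P →
                  Lowering (node X ts) (λ s → ∃ λ r → s ≡ node X (r ∷ us) × P r)
    lower-child {X} {ts} {u} {us} vt π (r , vr , r≼u , keep , p) =
      node X (r ∷ us) , vs , ≼-trans (≼-child vs r≼u) (inj₁ (≈-sym (node π))) , keep′ , r , refl , p
      where
      vs : ValidConstruction (node X (r ∷ us))
      vs = replace-child (validConstruction-resp (node π) vt) vr (≼-support r≼u)
      keep′ : ∀ {Y} → Stable Y → Tube Y (node X ts) → Tube Y (node X (r ∷ us))
      keep′ st p with Tube-resp (node π) p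
      ... | here e          = here (≡.trans (cong (λ S → X ∪ (S ∪ supports us)) (≼-support r≼u)) e)
      ... | there (here q)  = there (here (keep st q))
      ... | there (there q) = there (there q)

    -- This controls what can stand above `U`. If a subtree within `G` meets `U`, its root lies in
    -- no tube that avoids `U`: its only tube there is the whole subtree. The root is therefore in
    -- `U` or in `V`.
    Layered : Pred (Tree n) 0ℓ
    Layered t = ∀ {x} → x ∈ support t → x ∈ G → x ∉ U →
                x ∈ V ⊎ ∃ λ X → Tube X t × x ∈ X × Disjoint U X

    layered-child : ∀ {w} → Valid (node X ts) → ts ↭ u ∷ us → w ∈ U → w ∈ support (node X ts) →
                    Layered (node X ts) → Layered u
    layered-child (node _ _ F) π w∈U w∈t lay x∈u x∈G x∉U
      with lay (∪ʳ (subst (_ ∈_) (sym (supports-resp π)) (∪ˡ x∈u))) x∈G x∉U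
    ... | inj₁ x∈V = inj₁ x∈V
    ... | inj₂ (Y , here refl , x∈Y , d) = ⊥-elim (disjoint⁻ d w∈U w∈t)
    ... | inj₂ (Y , there p , x∈Y , d) with Tubes-resp π p
    ... | here q  = inj₂ (Y , q , x∈Y , d)
    ... | there q =
      let _ , _ , u#us , _ = forest-uncons (forest-resp π F)
      in ⊥-elim (disjoint⁻ u#us x∈u (tubes⊆supports q x∈Y))

    UpperRoot : Pred (Tree n) 0ℓ
    UpperRoot t = ∃₂ λ m ts → t ≡ node ⁅ m ⁆ ts × m ∈ U

    -- First raise an element `m` of `U` to the root of the child that contains `w`. If the root `r`
    -- above it is not in `U`, layering puts it in `V`, so `r < m` and a flip can be undone to
    -- exchange the two.
    raise-U : ∀ t → ValidConstruction t → support t ⊆ G → support t ⊆ vertices H → Layered t →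
      ∀ {w} → w ∈ U → w ∈ support t → Lowering t UpperRoot
    raise-U = Tree-elim Goal step
      where
      Goal : Pred (Tree n) 0ℓ
      Goal t = ValidConstruction t → support t ⊆ G → support t ⊆ vertices H → Layered t →
        ∀ {w} → w ∈ U → w ∈ support t → Lowering t UpperRoot
      step : ∀ {X ts} → All Goal ts → Goal (node X ts)
      step {ts = ts} ih vt@(v@(node _ X#ts F) , node (r , refl) sts) t⊆G t⊆H lay {w} w∈U w∈t
        with r ∈? U
      ... | yes r∈U = _ , vt , inj₁ ≈-refl , (λ _ p → p) , r , ts , refl , r∈U
      ... | no  r∉U with lay (∪ˡ (x∈⁅x⁆ r)) (t⊆G (∪ˡ (x∈⁅x⁆ r))) r∉U
      ... | inj₂ (_ , here refl , _ , d) = ⊥-elim (disjoint⁻ d w∈U w∈t)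
      ... | inj₂ (_ , there p , r∈Y , _) = ⊥-elim (disjoint⁻ X#ts (x∈⁅x⁆ r) (tubes⊆supports p r∈Y))
      ... | inj₁ r∈V
        with bring-to-front (supports⁻ ts (below-root ts w∈t λ w≡r → r∉U (subst (_∈ U) w≡r w∈U)))
      ... | c , cs , w∈c , c∈ , π =
        lowering-trans (lower-child {P = UpperRoot} vt π lowered) swap-up
        where
        c⊆t : support c ⊆ support (node ⁅ r ⁆ ts)
        c⊆t x∈c = ∪ʳ (supports⁺ (lose c∈ x∈c))
        lowered : Lowering c UpperRoot
        lowered = All.lookup ih c∈ (All.lookup (forest-valid F) c∈ , All.lookup sts c∈)
          (t⊆G ∘ c⊆t) (t⊆H ∘ c⊆t) (layered-child v π w∈U w∈t lay) w∈U w∈c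
        swap-up : ∀ {s} → ValidConstruction s → s ≼ node ⁅ r ⁆ ts →
                  (∀ {X} → Stable X → Tube X (node ⁅ r ⁆ ts) → Tube X s) →
                  (∃ λ r′ → s ≡ node ⁅ r ⁆ (r′ ∷ cs) × UpperRoot r′) → Lowering s UpperRoot
        swap-up vs@(node _ r#s _ , _) s≼t _ (_ , refl , m , ms , refl , m∈U)
          with unflip vs (V<U m∈U r∈V) (t⊆H ∘ subst (_ ∈_) (≼-support s≼t))
        ... | ss , flip@(vm , _) , tubes = _ , vm , inj₂ [ flip ] , keep , m , ss , refl , m∈U
          where
          -- The only tube that is lost contains m ∈ U but not r ∈ V.
          keep : ∀ {X} → Stable X → Tube X (node ⁅ r ⁆ (node ⁅ m ⁆ ms ∷ cs)) →
                 Tube X (node ⁅ m ⁆ ss)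
          keep st p with contract-tubes p
          ... | inj₂ q    = tubes q
          ... | inj₁ refl = ⊥-elim (disjoint⁻ r#s (x∈⁅x⁆ r) (∪ˡ (st m∈U (∪ˡ (x∈⁅x⁆ m)) r∈V)))

    module _ {d : Fin n} (d∈D : d ∈ D) (U#D : Disjoint U D) (D-connected : ConnectedSet D)
             (D-maximal : ∀ {W} → ConnectedSet W → W ⊆ G → Disjoint U W → d ∈ W → W ⊆ D) where

      -- With a vertex of `U` at the root, the connected set `D`, which avoids `U`, lies in a single
      -- child, where the argument is repeated. Once `U` is used up, maximality makes the remaining
      -- support equal to `D`. The recursion is on supports because `raise-U` returns a new tree.
      pull-within : ∀ t → Acc _⊂_ (support t) → ValidConstruction t → ConnectedSet (support t) →
        support t ⊆ G → support t ⊆ vertices H → D ⊆ support t → Layered t → Lowering t (Tube D)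
      pull-within t (acc rec) vt conn t⊆G t⊆H D⊆t lay with nonempty? (U ∩ support t)
      ... | no empty = t , vt , inj₁ ≈-refl , (λ _ p → p) ,
            here (⊆-antisym (D-maximal conn t⊆G empty (D⊆t d∈D)) D⊆t)
      ... | yes (w , w∈) =
        let w∈U , w∈t = x∈p∩q⁻ _ _ w∈
        in lowering-trans (raise-U t vt t⊆G t⊆H lay w∈U w∈t) descend
        where
        descend : ∀ {s} → ValidConstruction s → s ≼ t → (∀ {X} → Stable X → Tube X t → Tube X s) →
                  UpperRoot s → Lowering s (Tube D)
        descend {s} vs@(v@(node _ m#ss F) , node _ sss) s≼t keep (m , ss , refl , m∈U)
          with bring-to-front (supports⁻ ss
            (below-root ss (subst (d ∈_) (sym (≼-support s≼t)) (D⊆t d∈D))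
              λ d≡m → disjoint⁻ U#D m∈U (subst (_∈ D) d≡m d∈D)))
        ... | c , cs , d∈c , c∈ , π =
          let r , vr , r≼s , keep′ , _ , r≡ , D∈ = lower-child {P = Tube D} vs π lowered
          in r , vr , r≼s , keep′ , subst (Tube D) (sym r≡) (there (here D∈))
          where
          s⊆t : support s ⊆ support t
          s⊆t = subst (_ ∈_) (≼-support s≼t)
          D⊆ss : D ⊆ supports ss
          D⊆ss {x} x∈D = below-root ss (subst (x ∈_) (sym (≼-support s≼t)) (D⊆t x∈D))
            λ x≡m → disjoint⁻ U#D m∈U (subst (_∈ D) x≡m x∈D)
          F′ : Forest (c ∷ cs)
          F′ = forest-resp π F
          c⊆ss : support c ⊆ supports ss
          c⊆ss x∈c = supports⁺ (lose c∈ x∈c)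
          c⊆t : support c ⊆ support t
          c⊆t = s⊆t ∘ ∪ʳ ∘ c⊆ss
          D⊆c : D ⊆ support c
          D⊆c = connected⊆head F′ D-connected (subst (_ ∈_) (supports-resp π) ∘ D⊆ss) d∈D d∈c
          c⊂t : support c ⊂ support t
          c⊂t = c⊆t , m , s⊆t (∪ˡ (x∈⁅x⁆ m)) , λ m∈c → disjoint⁻ m#ss (x∈⁅x⁆ m) (c⊆ss m∈c)
          lay-s : Layered s
          lay-s x∈s x∈G x∉U with lay (s⊆t x∈s) x∈G x∉U
          ... | inj₁ x∈V                = inj₁ x∈V
          ... | inj₂ (Y , p , x∈Y , U#Y) = inj₂ (Y , keep (stable-disjoint U#Y) p , x∈Y , U#Y)
          lowered : Lowering c (Tube D)
          lowered = let vc , conn-c , _ = forest-uncons F′ in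
            pull-within c (rec c⊂t) (vc , All.lookup sss c∈) conn-c (t⊆G ∘ c⊆t) (t⊆H ∘ c⊆t) D⊆c
              (layered-child v π m∈U (∪ˡ (x∈⁅x⁆ m)) lay-s)

      -- `G` is a tube, so one can first descend to the subtree with support `G` and work there;
      -- maximality of `D` is only available within `G`.
      pull : ∀ {w} → w ∈ U → w ∈ G → D ⊆ G → ∀ t → ValidConstruction t → ConnectedSet (support t) →
        support t ⊆ vertices H → Tube G t → Layered t → Lowering t (Tube D)
      pull {w} w∈U w∈G D⊆G = Tree-elim _ step
        where
        Goal : Pred (Tree n) 0ℓ
        Goal t = ValidConstruction t → ConnectedSet (support t) →
          support t ⊆ vertices H → Tube G t → Layered t → Lowering t (Tube D)
        step : ∀ {X ts} → All Goal ts → Goal (node X ts)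
        step ih vt conn t⊆H (here refl) lay =
          pull-within _ (⊂-wellFounded _) vt conn id t⊆H D⊆G lay
        step {X} {ts} ih vt@(v@(node _ _ F) , node _ sts) conn t⊆H (there p) lay =
          let c , cs , q , c∈ , π = bring-to-front p
              vc , conn-c , _ = forest-uncons (forest-resp π F)
              c⊆t : support c ⊆ support (node X ts)
              c⊆t = λ x∈c → ∪ʳ (supports⁺ (lose c∈ x∈c))
              r , vr , r≼t , keep , _ , r≡ , D∈ = lower-child {P = Tube D} vt π
                (All.lookup ih c∈ (vc , All.lookup sts c∈) conn-c (t⊆H ∘ c⊆t) q
                  (layered-child v π w∈U (c⊆t (tube⊆support q w∈G)) lay))
          in r , vr , r≼t , keep , subst (Tube D) (sym r≡) (there (here D∈))

  -- The effect of a contraction on tubes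

  -- This collects what `Pull` requires of the contracted edge, independently of its depth in the
  -- tree. The tubes in `layered` are those of the children of the merged node.
  record Contraction (U V : Subset n) (s t : Tree n) : Set where
    field
      G D         : Subset n
      G-tube      : Tube G t
      D⊆G         : D ⊆ G
      U⊆G         : U ⊆ G
      V⊆D         : V ⊆ D
      U#D         : Disjoint U D
      D-connected : ConnectedSet D
      D-maximal   : ∀ {W x} → ConnectedSet W → W ⊆ G → Disjoint U W → x ∈ D → x ∈ W → W ⊆ D
      layered     : ∀ {x} → x ∈ G → x ∉ U → x ∈ V ⊎ ∃ λ X → Tube X t × x ∈ X × Disjoint U X
      D-only      : ∀ {X} → Tube X s → X ≡ D ⊎ Tube X t
      stable      : ∀ {X u} → Tube X t → u ∈ U → u ∈ X → V ⊆ X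

  contraction : ∀ {U V s t} → Contracts U V s t → Valid s → Contraction U V s t
  contraction {U} {V} (here {us} {ts}) v@(node _ U# F) with contract-valid v
  ... | node _ UV# _ = record
    { G           = support (node (U ∪ V) (us ++ ts))
    ; D           = support (node V us)
    ; G-tube      = here refl
    ; D⊆G         = subst (_ ∈_) (sym G≡) ∘ ∪ʳ ∘ ∪ˡ
    ; U⊆G         = ∪ˡ ∘ ∪ˡ
    ; V⊆D         = ∪ˡ
    ; U#D         = disjoint⁺ λ x∈U x∈D → disjoint⁻ U# x∈U (∪ˡ x∈D)
    ; D-connected = let _ , c , _ = forest-uncons F in c
    ; D-maximal   = λ c W⊆G U#W x∈D x∈W → connected⊆head F c
        (λ w∈W → [ (λ w∈U → ⊥-elim (disjoint⁻ U#W w∈U w∈W)) , id ]′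
          (∪⁻ (subst (_ ∈_) G≡ (W⊆G w∈W))))
        x∈W x∈D
    ; layered     = λ x∈G x∉U →
        [ [ ⊥-elim ∘ x∉U , inj₁ ]′ ∘ ∪⁻
        , (λ x∈L → let c , _ , x∈c , c∈ , _ = bring-to-front (supports⁻ (us ++ ts) x∈L) in
            inj₂ (support c , there (lose c∈ (here refl)) , x∈c
                 , disjoint⁺ λ y∈U y∈c → disjoint⁻ UV# (∪ˡ y∈U) (supports⁺ (lose c∈ y∈c))))
        ]′ (∪⁻ x∈G)
    ; D-only      = contract-tubes
    ; stable      = λ where
        (here refl) _   _   → ∪ˡ ∘ ∪ʳ
        (there p)   u∈U u∈X → ⊥-elim (disjoint⁻ UV# (∪ˡ u∈U) (tubes⊆supports p u∈X))
    }
    where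
    G≡ : support (node (U ∪ V) (us ++ ts)) ≡ support (node U (node V us ∷ ts))
    G≡ = contracts-support {X = U} {V} (here {us = us} {ts})
  contraction {U} {V} (there {Z} {s} {t} {ts} c) (node _ _ F) = record
    { G           = C.G
    ; D           = C.D
    ; G-tube      = G-tube
    ; D⊆G         = C.D⊆G
    ; U⊆G         = C.U⊆G
    ; V⊆D         = C.V⊆D
    ; U#D         = C.U#D
    ; D-connected = C.D-connected
    ; D-maximal   = C.D-maximal
    ; layered     = λ x∈G x∉U →
        [ inj₁ , (λ (X , p , r) → inj₂ (X , there (here p) , r)) ]′ (C.layered x∈G x∉U)
    ; D-only      = λ where
        (here e)          → inj₂ (here (≡.trans (contracts-support (there {Z = Z} {ts = ts} c)) e))
        (there (here p))  → [ inj₁ , (λ q → inj₂ (there (here q))) ]′ (C.D-only p)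
        (there (there p)) → inj₂ (there (there p))
    ; stable      = stable
    }
    where
    uncons = forest-uncons F
    module C = Contraction (contraction c (proj₁ uncons))
    G-tube : Tube C.G (node Z (t ∷ ts))
    G-tube = there (here C.G-tube)
    stable : ∀ {X u} → Tube X (node Z (t ∷ ts)) → u ∈ U → u ∈ X → V ⊆ X
    -- The whole tree contains `G`, hence `V`. Within the first child the inductive case applies,
    -- and the other children are disjoint from `G`, hence from `U`.
    stable (here refl)       _   _   = tube⊆support G-tube ∘ C.D⊆G ∘ C.V⊆D
    stable (there (here p))  u∈U u∈X = C.stable p u∈U u∈X
    stable (there (there p)) u∈U u∈X =
      ⊥-elim (disjoint⁻ (proj₁ (proj₂ (proj₂ uncons)))
        (subst (_ ∈_) (contracts-support c) (tube⊆support C.G-tube (C.U⊆G u∈U)))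
        (tubes⊆supports p u∈X))

  <ˢ⇒< : ∀ {U V} → V <ˢ U → ∀ {u v} → u ∈ U → v ∈ V → v < u
  <ˢ⇒< (a , b , (_ , ≤a) , (_ , b≤) , a≤b , a≢b) u∈U v∈V =
    ≤-trans (≤a v∈V) (≤-trans a≤b (b≤ u∈U)) ,
    λ { refl → a≢b (antisym a≤b (≤-trans (b≤ u∈U) (≤a v∈V))) }

  -- Refinement across fusions and splits

  Refines : Rel (Tree n) 0ℓ
  Refines t s = ∀ {X} → Tube X s → Tube X t

  -- The tubes of `s` are `D` and tubes of `s′`. The latter are stable, so they survive while `pull`
  -- creates `D`.
  refine-fusion : ∀ {U V s s′} → V <ˢ U → Contracts U V s s′ → Valid s →
    ValidConstruction t → ConnectedSet (support t) → support t ⊆ vertices H → Refines t s′ →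
    ∃ λ r → ValidConstruction r × r ≼ t × Refines r s
  refine-fusion {t} {U} {V} {s} V<U@(a , b , (a∈V , _) , (b∈U , _) , _) c vs vt conn t⊆H ref =
    let r , vr , r≼t , keep , D∈ = pulled in
    r , vr , r≼t , λ p → [ (λ X≡D → subst (λ X → Tube X r) (sym X≡D) D∈)
                         , (λ q → keep (C.stable q) (ref q)) ]′ (C.D-only p)
    where
    module C = Contraction (contraction c vs)
    open Pull {U} {V} {C.D} {C.G} (<ˢ⇒< V<U)
    pulled : Lowering t (Tube C.D)
    -- The maximum `a` of `V` and the minimum `b` of `U` serve as the required elements of `D` and
    -- of `U`.
    pulled = pull (C.V⊆D a∈V) C.U#D C.D-connected
      (λ c W⊆G U#W → C.D-maximal c W⊆G U#W (C.V⊆D a∈V)) b∈U (C.U⊆G b∈U) C.D⊆G t vt conn t⊆H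
      (ref C.G-tube)
      (λ _ x∈G x∉U → [ inj₁ , (λ (X , p , q) → inj₂ (X , ref p , q)) ]′ (C.layered x∈G x∉U))

  contracts-refines : Contracts X Y t u → Refines t u
  contracts-refines here p = uncontract-tubes p
  contracts-refines (there {Z} {ts = ts} c) (here e) =
    here (≡.trans (sym (contracts-support (there {Z = Z} {ts = ts} c))) e)
  contracts-refines (there c) (there (here p))  = there (here (contracts-refines c p))
  contracts-refines (there c) (there (there p)) = there (there p)

  -- Undoing the flip loses no tube other than the one contracted in passing to `s′`, so the new
  -- tree still refines `s′`. This supplies the last flip of the chain.
  unflip-split : ∀ {v u s s′} → v < u → Contracts ⁅ v ⁆ ⁅ u ⁆ s s′ → ValidConstruction s →
    support s ⊆ vertices H → ∃ λ t → t ⇝ s × Refines t s′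
  unflip-split v<u here vs s⊆H = let _ , flip , ref = unflip vs v<u s⊆H in _ , flip , ref
  unflip-split v<u (there {Z} {s} {s′} {ts} c) vs@(node _ _ F , node _ (ss ∷ _)) s⊆H =
    let t , flip@(vt , _ , eq , _) , ref =
          unflip-split v<u c (proj₁ (forest-uncons F) , ss) (s⊆H ∘ ∪ʳ ∘ ∪ˡ)
    in node Z (t ∷ ts) , ⇝-child (replace-child vs vt eq) flip , λ where
      (here e)          → here (≡.trans (cong (λ S → Z ∪ (S ∪ supports ts))
                            (≡.trans eq (sym (contracts-support c)))) e)
      (there (here p))  → there (here (ref p))
      (there (there p)) → there (there p)

  -- Constructions are determined by their tubes

  Determined : Pred (Tree n) 0ℓ
  Determined t = ∀ {u} → ValidConstruction t → ValidConstruction u → support t ≡ support u →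
                 Refines u t → t ≈ u

  -- The support of the first `t` is a tube inside some `u`. As `support u` is connected and meets
  -- `t`, it cannot be larger, so `t` and `u` are paired off. The remaining tubes are sorted by
  -- disjointness of supports.
  match : ∀ ts us → All Determined ts →
    Forest ts → All Singletons ts → Forest us → All Singletons us →
    supports ts ≡ supports us → (∀ {X} → Any (Tube X) ts → Any (Tube X) us) → ts ↭ us
  match [] [] _ _ _ _ _ _ _ = ↭-refl
  match [] (u ∷ us) _ _ _ F _ eq _ =
    let v , _ = forest-uncons F ; x , x∈u = valid-nonempty v
    in ⊥-elim (∉⊥ (subst (x ∈_) (sym eq) (∪ˡ x∈u)))
  match (t ∷ ts) us (det ∷ dets) F (st ∷ sts) F-us sus eq tubes
    with bring-to-front (tubes (here (here refl)))
  ... | u , us′ , q , _ , π with All-resp-↭ AllNodes-resp π sus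
  ... | su ∷ sus′ =
    trans (prep (det (vt , st) (vu , su) t≡u tubes-t)
                (match ts us′ dets F-ts sts F-us′ sus′ ts≡us′ tubes-ts))
          (↭-sym π)
    where
    t-uncons = forest-uncons F
    u-uncons = forest-uncons (forest-resp π F-us)
    vt = proj₁ t-uncons
    vu = proj₁ u-uncons
    t#ts = proj₁ (proj₂ (proj₂ t-uncons))
    u#us′ = proj₁ (proj₂ (proj₂ u-uncons))
    F-ts = proj₂ (proj₂ (proj₂ t-uncons))
    F-us′ = proj₂ (proj₂ (proj₂ u-uncons))
    eq′ : support t ∪ supports ts ≡ support u ∪ supports us′
    eq′ = ≡.trans eq (supports-resp π)
    t≡u : support t ≡ support u
    t≡u = ⊆-antisym t⊆u
      (let _ , x∈t = valid-nonempty vt in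
       connected⊆head F (proj₁ (proj₂ u-uncons)) (subst (_ ∈_) (sym eq′) ∘ ∪ˡ) (t⊆u x∈t) x∈t)
      where
      t⊆u : support t ⊆ support u
      t⊆u = tube⊆support q
    ts≡us′ : supports ts ≡ supports us′
    ts≡us′ = ⊆-antisym
      (λ x∈ts → [ (λ x∈u → ⊥-elim (disjoint⁻ t#ts (subst (_ ∈_) (sym t≡u) x∈u) x∈ts)) , id ]′
        (∪⁻ (subst (_ ∈_) eq′ (∪ʳ x∈ts))))
      (λ x∈us → [ (λ x∈t → ⊥-elim (disjoint⁻ u#us′ (subst (_ ∈_) t≡u x∈t) x∈us)) , id ]′
        (∪⁻ (subst (_ ∈_) (sym eq′) (∪ʳ x∈us))))
    tubes-t : Refines u t
    tubes-t p with Tubes-resp π (tubes (here p))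
    ... | here r  = r
    ... | there r = let x , x∈X = tube-nonempty vt p in
      ⊥-elim (disjoint⁻ u#us′ (subst (x ∈_) t≡u (tube⊆support p x∈X)) (tubes⊆supports r x∈X))
    tubes-ts : ∀ {X} → Any (Tube X) ts → Any (Tube X) us′
    tubes-ts p with Tubes-resp π (tubes (there p))
    ... | there r = r
    ... | here r  = let x , x∈X = tube-nonempty vu r in
      ⊥-elim (disjoint⁻ t#ts (subst (x ∈_) (sym t≡u) (tube⊆support r x∈X)) (tubes⊆supports p x∈X))

  -- The tubes of the children of `t` reappear strictly below the root `z` of `u`, so none contains
  -- `z`. As the children of `t` cover everything but its own root, the two roots agree, and `match`
  -- handles the children.
  refines⇒≈ : ∀ t → Determined t
  refines⇒≈ = Tree-elim Determined step
    where
    step : ∀ {X ts} → All Determined ts → Determined (node X ts)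
    step {ts = ts} dets {node _ us} (node _ x# F , node (x , refl) sts)
      (node _ z# F-us , node (z , refl) sus) eq ref =
      ≈-node (cong ⁅_⁆ (sym z≡x)) (match ts us dets F sts F-us sus ts≡us tubes)
      where
      x∉ts : x ∉ supports ts
      x∉ts = disjoint⁻ x# (x∈⁅x⁆ x)
      z∉us : z ∉ supports us
      z∉us = disjoint⁻ z# (x∈⁅x⁆ z)
      tubes : ∀ {X} → Any (Tube X) ts → Any (Tube X) us
      tubes p with ref (there p)
      ... | here refl = ⊥-elim (x∉ts (tubes⊆supports p (subst (x ∈_) eq (∪ˡ (x∈⁅x⁆ x)))))
      ... | there q   = q
      z∉ts : z ∉ supports ts
      z∉ts z∈ts = let c , _ , z∈c , c∈ , _ = bring-to-front (supports⁻ ts z∈ts) in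
        z∉us (tubes⊆supports (tubes (lose c∈ (here refl))) z∈c)
      z≡x : z ≡ x
      z≡x = [ ⁅⁆⁻ , ⊥-elim ∘ z∉ts ]′ (∪⁻ (subst (z ∈_) (sym eq) (∪ˡ (x∈⁅x⁆ z))))
      ts≡us : supports ts ≡ supports us
      ts≡us = ⊆-antisym
        (λ y∈ts → below-root us (subst (_ ∈_) eq (∪ʳ y∈ts)) λ { refl → z∉ts y∈ts })
        (λ y∈us → below-root ts (subst (_ ∈_) (sym eq) (∪ʳ y∈us))
          λ { refl → z∉us (subst (_∈ supports us) (sym z≡x) y∈us) })

  -- Passing between trees, constructs and constructions

  ⁅⁆-<ˢ : ∀ {x y} → y < x → ⁅ y ⁆ <ˢ ⁅ x ⁆
  ⁅⁆-<ˢ {x} {y} y<x =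
    y , x , (x∈⁅x⁆ y , ≤-reflexive ∘ ⁅⁆⁻) , (x∈⁅x⁆ x , ≤-reflexive ∘ sym ∘ ⁅⁆⁻) , y<x

  construct-valid : (S : Construct H) → let open Construct S in
                    Valid tree × support tree ≡ vertices H
  construct-valid S = construct⇒valid H self-induced (Construct.isConstruct S)

  toConstruct : Valid t → support t ≡ vertices H → Construct H
  toConstruct {t} v eq = record { tree = t ; isConstruct = valid⇒construct H self-induced v eq }

  -- The contracted tree is a construct `M` between `S` and `T`: fusing `y` into `x` leads to it,
  -- and a split for the same pair, now with `y` on top, leads on to `T`.
  flip⇒⋖⁺ : ∀ S T → S ⋖flip T → TransClosure _⋖_ (construct S) (construct T)
  flip⇒⋖⁺ S T (x , y , y<x , S′ , T′ , e , f , e′) =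
    let v , w , c , d , w≈v = flip-contracts f
        valid-S , sup = construct-valid (construct S)
        M = toConstruct (contracts-valid c (valid-resp e valid-S))
              (≡.trans (contracts-support c) (≡.trans (sym (support-resp e)) sup))
    in _∷_ {y = M} (⁅ x ⁆ , ⁅ y ⁆ , ⁅⁆-<ˢ y<x , inj₁ (S′ , v , e , c , ≈-refl))
         [ ⁅ x ⁆ , ⁅ y ⁆ , ⁅⁆-<ˢ y<x , inj₂ (T′ , w , ≈-sym e′ , d , w≈v) ]

  construction-valid : (S : Construction H) → ValidConstruction (Construction.tree S)
  construction-valid S = proj₁ (construct-valid (construct S)) , Construction.singletons S

  ⇝⁺⇒flip⁺ : ∀ S T → TransClosure _⇝_ (Construction.tree S) (Construction.tree T) →
             TransClosure _⋖flip_ S T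
  ⇝⁺⇒flip⁺ S T ss = go S ss refl
    where
    -- The end point is a free tree with an equation, so that the chain can be matched on. Each
    -- intermediate tree becomes a construction through the validity stored in `⇝`.
    go : ∀ S {t} → TransClosure _⇝_ (Construction.tree S) t → t ≡ Construction.tree T →
         TransClosure _⋖flip_ S T
    go S [ _ , _ , _ , x , y , y<x , f ] refl = [ x , y , y<x , f ]
    go S ((_ , (v , s) , eq , x , y , y<x , f) ∷ ss) refl = (x , y , y<x , f) ∷ go M ss refl
      where
      M : Construction H
      M = record
        { construct  = toConstruct v (≡.trans (sym eq) (proj₂ (construct-valid (construct S))))
        ; singletons = s }

  -- The merged label contains the distinct elements `a` and `b`. Hence no fusion ends in a
  -- construction.
  contracted-singletons : ∀ {U V} → V <ˢ U → Contracts U V t u → ¬ Singletons u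
  contracted-singletons {U = U} {V} (a , b , (a∈V , _) , (b∈U , _) , _ , a≢b) here
    (node (z , eq) _) =
    a≢b (≡.trans (⁅⁆⁻ (subst (a ∈_) eq (∪ʳ a∈V))) (sym (⁅⁆⁻ (subst (b ∈_) eq (∪ˡ b∈U)))))
  contracted-singletons V<U (there c) (node _ (s ∷ _)) = contracted-singletons V<U c s

  split-singletons : ∀ {U V} → Contracts V U t u → Singletons t → IsSingleton V × IsSingleton U
  split-singletons here      (node v (node u _ ∷ _)) = v , u
  split-singletons (there c) (node _ (s ∷ _))        = split-singletons c s

  -- From chains of fusions and splits to chains of flips

  module _ (H-connected : Connected H) (S : Construction H) where

    -- This is goodness of `P`, relative to the fixed starting point `S`.
    Below : Pred (Construct H) 0ℓ
    Below P = ∀ {t} → ValidConstruction t → support t ≡ vertices H → Refines t (Construct.tree P) →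
              Construction.tree S ≼ t

    H-connectedSet : ConnectedSet (vertices H)
    H-connectedSet = connected⇒connectedSet H self-induced H-connected

    below-self : Below (construct S)
    below-self vt eq ref = inj₁ (refines⇒≈ _ (construction-valid S) vt
      (≡.trans (proj₂ (construct-valid (construct S))) (sym eq)) ref)

    -- After a fusion, `t` is lowered to a tree `r` that also refines `P`, whence `S ≼ r ≼ t`. After
    -- a split, `t` refines `P` already.
    below-step : ∀ {P Q} → P ⋖ Q → Below P → Below Q
    below-step {P} {Q} (U , V , V<U , inj₁ (s , s′ , e , c , e′)) below vt eq ref =
      let vs = valid-resp e (proj₁ (construct-valid P))
          r , vr , r≼t , ref′ = refine-fusion V<U c vs vt
            (subst ConnectedSet (sym eq) H-connectedSet) (subst (_ ∈_) eq)
            (ref ∘ Tube-resp e′)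
      in ≼-trans (below vr (≡.trans (≼-support r≼t) eq) (ref′ ∘ Tube-resp e)) r≼t
    below-step (_ , _ , _ , inj₂ (s , s′ , e , c , e′)) below vt eq ref =
      below vt eq (ref ∘ Tube-resp (≈-sym e) ∘ contracts-refines c ∘ Tube-resp (≈-sym e′))

    -- The last step is a split between singletons. Undoing its flip gives a tree that refines `P`,
    -- hence lies above `S`, and the flip back to `T` makes the chain non-empty.
    below-last : ∀ {P} T → P ⋖ construct T → Below P →
                 TransClosure _⇝_ (Construction.tree S) (Construction.tree T)
    below-last T (_ , _ , V<U , inj₁ (_ , _ , _ , c , e)) _ =
      ⊥-elim (contracted-singletons V<U c (AllNodes-resp (≈-sym e) (Construction.singletons T)))
    below-last T (U , V , V<U , inj₂ (s , s′ , e , c , e′)) below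
      with validConstruction-resp e (construction-valid T)
    ... | vs with split-singletons c (proj₂ vs)
    ... | (v , refl) , (u , refl) =
      let s≡H = ≡.trans (sym (support-resp e)) (proj₂ (construct-valid (construct T)))
          t , flip@(vt , _ , eq , _) , ref =
            unflip-split (<ˢ⇒< V<U (x∈⁅x⁆ u) (x∈⁅x⁆ v)) c vs (subst (_ ∈_) s≡H)
      in ≼-⇝-trans (below vt (≡.trans eq s≡H) (ref ∘ Tube-resp (≈-sym e′)))
                   (⇝-respʳ flip (≈-sym e))

    ⋖⁺⇒flip⁺ : ∀ T → TransClosure _⋖_ (construct S) (construct T) → TransClosure _⋖flip_ S T
    ⋖⁺⇒flip⁺ T steps = ⇝⁺⇒flip⁺ S T (go below-self steps refl)
      where
      go : ∀ {P Q} → Below P → TransClosure _⋖_ P Q → Q ≡ construct T →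
           TransClosure _⇝_ (Construction.tree S) (Construction.tree T)
      go {P} below [ s ]         refl = below-last {P} T s below
      go {P} below (_∷_ {y = Q} s ss) eq = go (below-step {P} {Q} s below) ss eq

proposition2p30 : ∀ {n} (H : OrderedHypergraph n) → let open OrderedHypergraph H in
    Connected hypergraph → (S T : Construction hypergraph) →
    (S ⋖flip T → TransClosure _⋖_ (construct S) (construct T))
    × (HereditarilyOrdered → TransClosure _⋖_ (construct S) (construct T) →
    TransClosure _⋖flip_ S T)
proposition2p30 H connected S T =
  Flipping.flip⇒⋖⁺ H S T , λ _ → Flipping.⋖⁺⇒flip⁺ H connected S T
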